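{- Assuming that all distances in the input are non-negative integers bounded by a polynomial in the input size, the $k$-median Facility Location problem with $n$ clients and $m$ candidate centers can be solved optimally in time $2^n\cdot \mathrm{poly}(m,n)$.
   Context: $k$-median Facility Location: the input is a metric space $(X\cup F,d)$, where $X=\{x_1,\dots,x_n\}$ is a set of $n$ points called clients and $F$ is a set of $m$ candidate centers (facilities), together with a positive integer $k$. The task is to find a pair $(C,P)$, where $C=\{c_1,\dots,c_k\}\subseteq F$ is a set of size at most $k$ and $P$ is a partition of $X$ into $k$ clusters $X_1,\dots,X_k$ such that each client in $X_i$ is assigned to $c_i$, minimizing $\mathrm{cost}(C,P)=\sum_{i=1}^{k}\sum_{x\in X_i} d(c_i,x)$. The boundedness assumption means that the maximum inter-point distance $D$ in the input satisfies $D=\mathrm{poly}(m,n)$ (so each distance, encoded in binary, has length $O(\log m+\log n)$). -}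

module Defs where

open import Data.Bool.Base using (if_then_else_)
open import Data.Fin.Base using (Fin; toℕ)
import Data.Fin.Properties as Fin
open import Data.List.Base using (List; []; _∷_; _++_; concat; length; lookup; tabulate)
open import Data.Nat.Base
  using (ℕ; zero; suc; _+_; _∸_; _*_; _/_; _≤_; _≡ᵇ_; NonZero)
open import Data.Nat.Binary.Base using (ℕᵇ; zero; 2[1+_]; 1+[2_]; fromℕ)
open import Data.Nat.Logarithm using (⌊log₂_⌋)
open import Data.Nat.Properties using (+-0-commutativeMonoid)
open import Data.Product.Base using (∃-syntax)
open import Data.Sum.Base using (_⊎_)
import Data.Vec.Functional as Vector
open import Function.Definitions using (Injective)
open import Function.Metric.Nat.Bundles using (Metric)
open import Level using (0ℓ) renaming (suc to lsuc)
open import Relation.Binary.PropositionalEquality.Core using (_≡_; _≢_)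
open import Relation.Nullary.Decidable.Core using (does)

open import Algebra.Properties.CommutativeMonoid.Sum +-0-commutativeMonoid
  using (sum-syntax)

------------------------------------------------------------------------
-- Polynomials in two indeterminates

-- Polynomials occur only as upper bounds, so natural-number coefficients
-- lose no generality.

infixl 6 _:+_
infixl 7 _:*_

data Poly : Set where
  con   : ℕ → Poly
  𝑚 𝑛   : Poly
  _:+_  : Poly → Poly → Poly
  _:*_  : Poly → Poly → Poly

⟦_⟧ : Poly → ℕ → ℕ → ℕ
⟦ con c ⟧  m n = c
⟦ 𝑚 ⟧      m n = m
⟦ 𝑛 ⟧      m n = n
⟦ p :+ q ⟧ m n = ⟦ p ⟧ m n + ⟦ q ⟧ m n
⟦ p :* q ⟧ m n = ⟦ p ⟧ m n * ⟦ q ⟧ m n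

------------------------------------------------------------------------
-- k-median Facility Location

record Instance (m n : ℕ) : Set (lsuc 0ℓ) where
  field
    space : Metric 0ℓ 0ℓ

  open Metric space public using (Carrier; _≈_; d)

  -- The carrier is X ∪ F, a union that need not be disjoint: a point may
  -- be both a client and a facility.
  field
    client             : Fin n → Carrier
    facility           : Fin m → Carrier
    client-injective   : Injective _≡_ _≈_ client
    facility-injective : Injective _≡_ _≈_ facility
    covering           : ∀ x → (∃[ j ] client j ≈ x) ⊎ (∃[ i ] facility i ≈ x)
    k                  : ℕ
    k-nonZero          : NonZero k
    -- Otherwise there would be no c₁ ∈ F to choose.
    m-nonZero          : NonZero m

module _ {m n : ℕ} (I : Instance m n) where
  open Instance I

  -- C = {c₁,…,c_r} with r ≤ k, and Xᵢ = { j ∣ cluster j ≡ i }. Centers may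
  -- repeat and clusters may be empty. Having r ≤ k rather than r = k allows
  -- empty clusters to be left out; they cost nothing.
  record Solution : Set where
    field
      r       : ℕ
      r≤k     : r ≤ k
      center  : Fin r → Fin m
      cluster : Fin n → Fin r

  cost : Solution → ℕ
  cost S = ∑[ i < r ] ∑[ j < n ]
             (if does (cluster j Fin.≟ i) then d (facility (center i)) (client j) else 0)
    where open Solution S

  Optimal : Solution → Set
  Optimal S = ∀ S′ → cost S ≤ cost S′

------------------------------------------------------------------------
-- Random access machine with logarithmic cost

-- Programs are structured rather than made of jumps. Memory consists of
-- variables and of arrays, both holding unbounded natural numbers; a program
-- mentions finitely many variables and arrays, by fixed names.

data Op : Set where
  add sub mul div : Op

data Expr : Set where
  lit   : ℕ → Expr
  var   : ℕ → Expr
  _[_]  : ℕ → Expr → Expr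
  binop : Op → Expr → Expr → Expr

infixr 5 _⨾_

data Program : Set where
  skip          : Program
  _:=_          : ℕ → Expr → Program
  _[_]:=_       : ℕ → Expr → Expr → Program
  _⨾_           : Program → Program → Program
  ifNonZero     : Expr → Program → Program → Program
  whileNonZero  : Expr → Program → Program

record State : Set where
  constructor ⟨_,_⟩
  field
    variables : ℕ → ℕ
    arrays    : ℕ → ℕ → ℕ

open State public

_[_↦_] : {A : Set} → (ℕ → A) → ℕ → A → (ℕ → A)
(f [ x ↦ v ]) y = if x ≡ᵇ y then v else f y

-- Subtraction is truncated, division rounds down, and v / 0 = 0.
apply : Op → ℕ → ℕ → ℕ
apply add v w       = v + w
apply sub v w       = v ∸ w
apply mul v w       = v * w
apply div v zero    = 0
apply div v (suc w) = v / suc w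

eval : Expr → State → ℕ
eval (lit v)           s = v
eval (var x)           s = variables s x
eval (a [ e ])         s = arrays s a (eval e s)
eval (binop o e₁ e₂)   s = apply o (eval e₁ s) (eval e₂ s)

-- The length of v in binary (⌊log₂ 0 ⌋ is 0).
size : ℕ → ℕ
size v = suc ⌊log₂ v ⌋

-- An array access pays for the address as well as for the contents. An
-- operation pays the product of the operand lengths, as in schoolbook
-- multiplication and division.
evalCost : Expr → State → ℕ
evalCost (lit v)           s = size v
evalCost (var x)           s = size (variables s x)
evalCost (a [ e ])         s = evalCost e s + size (eval e s) + size (eval (a [ e ]) s)
evalCost (binop o e₁ e₂)   s =
  evalCost e₁ s + evalCost e₂ s + size (eval e₁ s) * size (eval e₂ s)

-- P ∶ s ⇓ s′ within t: started in s, the program P halts in s′ after time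
-- exactly t.
infix 4 _∶_⇓_within_

data _∶_⇓_within_ : Program → State → State → ℕ → Set where

  ⇓skip : ∀ {s} → skip ∶ s ⇓ s within 1

  ⇓assign : ∀ {x e s} →
    (x := e) ∶ s ⇓ ⟨ variables s [ x ↦ eval e s ] , arrays s ⟩
      within suc (evalCost e s + size (eval e s))

  ⇓store : ∀ {a e₁ e₂ s} →
    (a [ e₁ ]:= e₂) ∶ s
      ⇓ ⟨ variables s , arrays s [ a ↦ arrays s a [ eval e₁ s ↦ eval e₂ s ] ] ⟩
      within suc (evalCost e₁ s + size (eval e₁ s) + evalCost e₂ s + size (eval e₂ s))

  ⇓seq : ∀ {P Q s s′ s″ t u} →
    P ∶ s ⇓ s′ within t →
    Q ∶ s′ ⇓ s″ within u →
    (P ⨾ Q) ∶ s ⇓ s″ within t + u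

  ⇓then : ∀ {e P Q s s′ t} →
    eval e s ≢ 0 →
    P ∶ s ⇓ s′ within t →
    ifNonZero e P Q ∶ s ⇓ s′ within suc (evalCost e s + t)

  ⇓else : ∀ {e P Q s s′ t} →
    eval e s ≡ 0 →
    Q ∶ s ⇓ s′ within t →
    ifNonZero e P Q ∶ s ⇓ s′ within suc (evalCost e s + t)

  ⇓stop : ∀ {e P s} →
    eval e s ≡ 0 →
    whileNonZero e P ∶ s ⇓ s within suc (evalCost e s)

  ⇓loop : ∀ {e P s s′ s″ t u} →
    eval e s ≢ 0 →
    P ∶ s ⇓ s′ within t →
    whileNonZero e P ∶ s′ ⇓ s″ within u →
    whileNonZero e P ∶ s ⇓ s″ within suc (evalCost e s + t + u)

------------------------------------------------------------------------
-- Input and output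

-- Bijective base-2 digits (1 and 2), least significant first.
digits : ℕᵇ → List ℕ
digits zero     = []
digits 2[1+ x ] = 2 ∷ digits x
digits 1+[2 x ] = 1 ∷ digits x

-- m, n, and the distance matrix of the n clients followed by the m
-- facilities, row by row, one number per cell; then k. As k is not bounded in
-- terms of m and n, just reading a cell that contains it could already exceed
-- any bound in m and n. It is therefore given digit by digit, the end being
-- marked by the zero cells that follow, so that a program can stop reading
-- once k is known to be large.
encodeInstance : ∀ {m n} → Instance m n → List ℕ
encodeInstance {m} {n} I =
  m ∷ n ∷ concat (tabulate λ i → tabulate λ j → d (point i) (point j))
    ++ digits (fromℕ k)
  where
  open Instance I
  point : Fin (n + m) → Carrier
  point = client Vector.++ facility

encodeSolution : ∀ {m n} {I : Instance m n} → Solution I → List ℕ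
encodeSolution S =
  r ∷ tabulate (λ i → toℕ (center i)) ++ tabulate (λ j → toℕ (cluster j))
  where open Solution S

fromList : List ℕ → ℕ → ℕ
fromList []       i       = 0
fromList (v ∷ vs) zero    = v
fromList (v ∷ vs) (suc i) = fromList vs i

-- The input occupies array 0; everything else is initially zero.
initial : List ℕ → State
initial vs = ⟨ (λ _ → 0) , (λ _ _ → 0) [ 0 ↦ fromList vs ] ⟩

-- The output is read off an initial segment of array 1. What follows it is
-- irrelevant, since an encoded solution determines its own length, given n.
Outputs : State → List ℕ → Set
Outputs s vs = ∀ (i : Fin (length vs)) → arrays s 1 (toℕ i) ≡ lookup vs i

{-# OPTIONS --safe #-}
module Submission where

-- Give client x the weight u(c,x) = 2^{μ(D − d(c,x))} under center c and let
-- E = 2^{μD}. For a tuple c of k centers, Π_l (E + u(c_l,x)) − E^k is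
-- E^{k−1} 2^{μ(D − min_l d(c_l,x))} up to a factor between 1 and 2^k, so for
-- large μ the product over x, called the weight of c, determines the cost of c.
-- Expanding that product by inclusion–exclusion, the total weight of all tuples is
--   Σ_{S ⊆ X} (−1)^{|X∖S|} Π_l Σ_c Π_x (E + [x ∈ S] u(c,x)),
-- where each of the 2^n terms is computed in polynomial time, and the same holds
-- when some slots of the tuple are already fixed. Filling the slots one by one,
-- each time with a center of largest remaining total, loses at most a factor m per
-- slot. As 2^μ > m^k 2^{kn}, the resulting tuple is optimal. The number of slots
-- is min(k,m), which can be found from the first m digits of k.

open import Data.Bool.Base using (Bool; true; false; _∨_; if_then_else_)
open import Data.Fin.Base as Fin using (Fin; zero; suc; toℕ; fromℕ<; _↑ˡ_; _↑ʳ_)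
import Data.Fin.Properties as Fin
open import Data.List.Base using (List; []; _∷_; _++_; concat; length; lookup; tabulate)
open import Data.List.Membership.Propositional using (_∈_)
open import Data.List.Properties using (++-assoc)
open import Data.List.Relation.Unary.Any using (here; there)
open import Data.Nat.Base hiding (parity)
open import Data.Nat.Binary.Base using (ℕᵇ; 2[1+_]; 1+[2_]; fromℕ) renaming (zero to 0ᵇ; toℕ to toℕᵇ)
open import Data.Nat.Binary.Properties using (toℕ-fromℕ)
open import Data.Nat.DivMod using (m*n/n≡m; m/n*n≤m; m/n≤m; m≡m%n+[m/n]*n; m%n<n; /-monoˡ-≤)
open import Data.Nat.Logarithm using (⌊log₂⌋-mono-≤; ⌊log₂[2^n]⌋≡n)
open import Data.Nat.Properties
open import Data.Nat.Tactic.RingSolver using (solve-∀)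
open import Data.Product.Base using (_×_; _,_; proj₁; proj₂; ∃-syntax; Σ-syntax)
open import Data.Sum.Base using (_⊎_; inj₁; inj₂)
import Data.Vec.Functional as Vector
open import Data.Vec.Functional.Properties using (lookup-++ˡ; lookup-++ʳ)
open import Defs
open import Function.Base using (_∘_)
open import Relation.Binary.Definitions using (tri<; tri≈; tri>)
open import Relation.Binary.PropositionalEquality hiding ([_])
open import Relation.Nullary.Decidable.Core using (does; no; yes)
open import Relation.Nullary.Negation using (contradiction)

open import Algebra.Properties.CommutativeMonoid.Sum +-0-commutativeMonoid
  using (sum; ∑-comm; sum-cong-≗; sum-replicate-zero)

-- Time and memory bounds for programs

-- Minimizing a cost is a computation over (min, +), where inclusion-exclusion fails for want of
-- subtraction; distances placed in exponents of 2 turn it into ordinary arithmetic. Here the bound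
-- on the distances enters: with D polynomial, all numbers have polynomially many bits, as the
-- logarithmic cost measure demands. Each slot picks an arbitrary subset of S as its cluster, and a
-- client outside it contributes E, the value of `u` at distance 0. Because clusters may be
-- arbitrary subsets and not parts of a partition, the sum over them factors over the clients, and
-- no table indexed by subsets is needed. Overlaps do no harm: a further membership of a client only
-- replaces a factor E by some u ≤ E. Since costs are integers, they survive the inexact weights.
-- The clusters themselves are never recovered from the sums: only the centers are extracted, and
-- each client then goes to a nearest one. As numbers carry no sign, positive and negative terms are
-- accumulated apart.

∨-falseˡ : ∀ {a b} → a ∨ b ≡ false → a ≡ false
∨-falseˡ {false} eq = refl

∨-falseʳ : ∀ {a b} → a ∨ b ≡ false → b ≡ false
∨-falseʳ {false} eq = eq

-- Frame conditions are Boolean functions of the program text, so that for a concrete program and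
-- variable they hold by `refl`.
writesVar : Program → ℕ → Bool
writesVar skip                 y = false
writesVar (x := e)             y = x ≡ᵇ y
writesVar (a [ e₁ ]:= e₂)      y = false
writesVar (P ⨾ Q)              y = writesVar P y ∨ writesVar Q y
writesVar (ifNonZero e P Q)    y = writesVar P y ∨ writesVar Q y
writesVar (whileNonZero e P)   y = writesVar P y

writesArr : Program → ℕ → Bool
writesArr skip                 b = false
writesArr (x := e)             b = false
writesArr (a [ e₁ ]:= e₂)      b = a ≡ᵇ b
writesArr (P ⨾ Q)              b = writesArr P b ∨ writesArr Q b
writesArr (ifNonZero e P Q)    b = writesArr P b ∨ writesArr Q b
writesArr (whileNonZero e P)   b = writesArr P b

KeepsVars : Program → State → State → Set
KeepsVars P s s′ = ∀ y → writesVar P y ≡ false → variables s′ y ≡ variables s y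

KeepsArrs : Program → State → State → Set
KeepsArrs P s s′ = ∀ b → writesArr P b ≡ false → arrays s′ b ≡ arrays s b

keepsVars : ∀ {P s s′ t} → P ∶ s ⇓ s′ within t → KeepsVars P s s′
keepsVars ⇓skip                y w = refl
keepsVars (⇓assign {x})        y w with x ≡ᵇ y | w
... | false | _ = refl
keepsVars ⇓store               y w = refl
keepsVars (⇓seq D D′)          y w =
  trans (keepsVars D′ y (∨-falseʳ w)) (keepsVars D y (∨-falseˡ w))
keepsVars (⇓then _ D)          y w = keepsVars D y (∨-falseˡ w)
keepsVars (⇓else _ D)          y w = keepsVars D y (∨-falseʳ w)
keepsVars (⇓stop _)            y w = refl
keepsVars (⇓loop _ D D′)       y w = trans (keepsVars D′ y w) (keepsVars D y w)

keepsArrs : ∀ {P s s′ t} → P ∶ s ⇓ s′ within t → KeepsArrs P s s′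
keepsArrs ⇓skip                b w = refl
keepsArrs ⇓assign              b w = refl
keepsArrs (⇓store {a})         b w with a ≡ᵇ b | w
... | false | _ = refl
keepsArrs (⇓seq D D′)          b w =
  trans (keepsArrs D′ b (∨-falseʳ w)) (keepsArrs D b (∨-falseˡ w))
keepsArrs (⇓then _ D)          b w = keepsArrs D b (∨-falseˡ w)
keepsArrs (⇓else _ D)          b w = keepsArrs D b (∨-falseʳ w)
keepsArrs (⇓stop _)            b w = refl
keepsArrs (⇓loop _ D D′)       b w = trans (keepsArrs D′ b w) (keepsArrs D b w)

-- Counts the size terms charged by `evalCost`, each of which will be at most `κ`: an array access
-- pays for address and contents, hence the 2.
weight : Expr → ℕ
weight (lit v)         = 1
weight (var x)         = 1
weight (a [ e ])       = weight e + 2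
weight (binop o e₁ e₂) = weight e₁ + weight e₂ + 1

bound : (ℕ → ℕ) → Expr → ℕ
bound β (var x) = β x
bound β _       = 0

-- If every loop runs on a counter x that starts at most at β x, then count β P
-- bounds the number of elementary steps of P.
count : (ℕ → ℕ) → Program → ℕ
count β skip                 = 1
count β (x := e)             = weight e + 2
count β (a [ e₁ ]:= e₂)      = weight e₁ + weight e₂ + 3
count β (P ⨾ Q)              = count β P + count β Q
count β (ifNonZero e P Q)    = weight e + 1 + (count β P + count β Q)
count β (whileNonZero e P)   = bound β e * (weight e + 1 + count β P) + (weight e + 1)

-- The decrement precedes the body, so a counter started at b shows the body b - 1, ..., 0, the
-- order in which `∑<` and `∏<` peel off their terms.
loop : ℕ → Program → Program
loop i P = whileNonZero (var i) (i := binop sub (var i) (lit 1) ⨾ P)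

set : ℕ → ℕ → State → State
set x v s = ⟨ variables s [ x ↦ v ] , arrays s ⟩

store : ℕ → ℕ → ℕ → State → State
store a i v s = ⟨ variables s , arrays s [ a ↦ arrays s a [ i ↦ v ] ] ⟩

-- All numbers occurring in a run are kept below N, so that κ bounds the time of
-- an elementary step.
module Machine (N : ℕ) (β : ℕ → ℕ) where

  κ : ℕ
  κ = size N * size N

  size≤ : ∀ {v} → v ≤ N → size v ≤ size N
  size≤ v≤N = s≤s (⌊log₂⌋-mono-≤ v≤N)

  size≤κ : ∀ {v} → v ≤ N → size v ≤ κ
  size≤κ v≤N = ≤-trans (size≤ v≤N) (m≤m*n (size N) (size N))

  1≤κ : 1 ≤ κ
  1≤κ = s≤s z≤n

  record Ev (e : Expr) (s : State) (v : ℕ) : Set where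
    constructor ev
    field
      value : eval e s ≡ v
      small : v ≤ N
      cheap : evalCost e s ≤ weight e * κ

  open Ev public

  ev-lit : ∀ {v s} → v ≤ N → Ev (lit v) s v
  ev-lit v≤N = ev refl v≤N (≤-trans (size≤κ v≤N) (m≤m+n κ 0))

  ev-var : ∀ {x s v} → variables s x ≡ v → v ≤ N → Ev (var x) s v
  ev-var refl v≤N = ev refl v≤N (≤-trans (size≤κ v≤N) (m≤m+n κ 0))

  ev-arr : ∀ {a e s i v} → Ev e s i → arrays s a i ≡ v → v ≤ N → Ev (a [ e ]) s v
  ev-arr {e = e} (ev refl i≤N c) refl v≤N = ev refl v≤N (begin
    _ ≤⟨ +-mono-≤ (+-mono-≤ c (size≤κ i≤N)) (size≤κ v≤N) ⟩
    weight e * κ + κ + κ ≡⟨ lemma (weight e) κ ⟩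
    (weight e + 2) * κ   ∎)
    where
    open ≤-Reasoning
    lemma : ∀ w k → w * k + k + k ≡ (w + 2) * k
    lemma = solve-∀

  private
    ev-binop : ∀ {o e₁ e₂ s v w u} → Ev e₁ s v → Ev e₂ s w → apply o v w ≡ u → u ≤ N →
               Ev (binop o e₁ e₂) s u
    ev-binop {o} {e₁} {e₂} (ev refl v≤N c) (ev refl w≤N d) refl u≤N = ev refl u≤N (begin
      _ ≤⟨ +-mono-≤ (+-mono-≤ c d) (*-mono-≤ (size≤ v≤N) (size≤ w≤N)) ⟩
      weight e₁ * κ + weight e₂ * κ + κ ≡⟨ lemma (weight e₁) (weight e₂) κ ⟩
      (weight e₁ + weight e₂ + 1) * κ   ∎)
      where
      open ≤-Reasoning
      lemma : ∀ w v k → w * k + v * k + k ≡ (w + v + 1) * k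
      lemma = solve-∀

  ev-add : ∀ {e₁ e₂ s v w} → Ev e₁ s v → Ev e₂ s w → v + w ≤ N → Ev (binop add e₁ e₂) s (v + w)
  ev-add p q = ev-binop p q refl

  ev-mul : ∀ {e₁ e₂ s v w} → Ev e₁ s v → Ev e₂ s w → v * w ≤ N → Ev (binop mul e₁ e₂) s (v * w)
  ev-mul p q = ev-binop p q refl

  ev-sub : ∀ {e₁ e₂ s v w} → Ev e₁ s v → Ev e₂ s w → Ev (binop sub e₁ e₂) s (v ∸ w)
  ev-sub {v = v} {w} p q = ev-binop p q refl (≤-trans (m∸n≤m v w) (small p))

  ev-div : ∀ {e₁ e₂ s v w} → Ev e₁ s v → Ev e₂ s (suc w) → Ev (binop div e₁ e₂) s (v / suc w)
  ev-div {v = v} {w} p q = ev-binop p q refl (≤-trans (m/n≤m v (suc w)) (small p))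

  ev-≡ : ∀ {e s v w} → v ≡ w → Ev e s v → Ev e s w
  ev-≡ refl p = p

  -- `Q` need not record what `P` leaves alone: the rules for composition and loops hand the frame
  -- facts on to the next step.
  Run : Program → State → (State → Set) → Set
  Run P s Q = ∃[ s′ ] ∃[ t ] ((P ∶ s ⇓ s′ within t) × t ≤ count β P * κ × Q s′)

  run-map : ∀ {P s Q R} → Run P s Q →
            (∀ s′ → KeepsVars P s s′ → KeepsArrs P s s′ → Q s′ → R s′) → Run P s R
  run-map (s′ , t , D , t≤ , q) f = s′ , t , D , t≤ , f s′ (keepsVars D) (keepsArrs D) q

  run-skip : ∀ {s Q} → Q s → Run skip s Q
  run-skip q = _ , _ , ⇓skip , ≤-trans 1≤κ (m≤m+n κ 0) , q

  run-assign : ∀ {x e s v Q} → Ev e s v → Q (set x v s) → Run (x := e) s Q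
  run-assign {e = e} (ev refl v≤N c) q = _ , _ , ⇓assign , (begin
    _ ≤⟨ +-mono-≤ 1≤κ (+-mono-≤ c (size≤κ v≤N)) ⟩
    κ + (weight e * κ + κ) ≡⟨ lemma (weight e) κ ⟩
    (weight e + 2) * κ ∎) , q
    where
    open ≤-Reasoning
    lemma : ∀ w k → k + (w * k + k) ≡ (w + 2) * k
    lemma = solve-∀

  run-store : ∀ {a e₁ e₂ s i v Q} → Ev e₁ s i → Ev e₂ s v → Q (store a i v s) →
              Run (a [ e₁ ]:= e₂) s Q
  run-store {e₁ = e₁} {e₂} (ev refl i≤N c) (ev refl v≤N d) q = _ , _ , ⇓store , (begin
    _ ≤⟨ +-mono-≤ 1≤κ (+-mono-≤ (+-mono-≤ (+-mono-≤ c (size≤κ i≤N)) d) (size≤κ v≤N)) ⟩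
    κ + (weight e₁ * κ + κ + weight e₂ * κ + κ) ≡⟨ lemma (weight e₁) (weight e₂) κ ⟩
    (weight e₁ + weight e₂ + 3) * κ ∎) , q
    where
    open ≤-Reasoning
    lemma : ∀ w v k → k + (w * k + k + v * k + k) ≡ (w + v + 3) * k
    lemma = solve-∀

  run-seq : ∀ {P Q s R T} → Run P s R →
            (∀ s′ → KeepsVars P s s′ → KeepsArrs P s s′ → R s′ → Run Q s′ T) →
            Run (P ⨾ Q) s T
  run-seq {P} {Q} (s′ , t , D , t≤ , r) f with f s′ (keepsVars D) (keepsArrs D) r
  ... | s″ , u , D′ , u≤ , q =
    s″ , t + u , ⇓seq D D′ ,
    ≤-trans (+-mono-≤ t≤ u≤) (≤-reflexive (sym (*-distribʳ-+ κ (count β P) (count β Q)))) , q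

  infixr 4 _then_

  _then_ : ∀ {x e Q s v T} → Ev e s v → Run Q (set x v s) T → Run ((x := e) ⨾ Q) s T
  _then_ {x} {e} {Q} {s} {v} {T} p r =
    run-seq {R = λ s′ → Run Q s′ T} (run-assign {Q = λ s′ → Run Q s′ T} p r) λ _ _ _ r → r

  run-if : ∀ {e P Q s v R} → Ev e s v → (v ≢ 0 → Run P s R) → (v ≡ 0 → Run Q s R) →
           Run (ifNonZero e P Q) s R
  run-if {e} {P} {Q} {v = zero} (ev eq v≤N c) f g with g refl
  ... | s′ , t , D , t≤ , q = s′ , _ , ⇓else eq D , (begin
    _ ≤⟨ +-mono-≤ 1≤κ (+-mono-≤ c (≤-trans t≤ (*-monoˡ-≤ κ (m≤n+m (count β Q) (count β P))))) ⟩
    κ + (weight e * κ + (count β P + count β Q) * κ) ≡⟨ lemma (weight e) (count β P + count β Q) κ ⟩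
    (weight e + 1 + (count β P + count β Q)) * κ ∎) , q
    where
    open ≤-Reasoning
    lemma : ∀ w v k → k + (w * k + v * k) ≡ (w + 1 + v) * k
    lemma = solve-∀
  run-if {e} {P} {Q} {v = suc v} (ev eq v≤N c) f g with f (λ ())
  ... | s′ , t , D , t≤ , q = s′ , _ , ⇓then (λ z → contradiction (trans (sym z) eq) λ ()) D , (begin
    _ ≤⟨ +-mono-≤ 1≤κ (+-mono-≤ c (≤-trans t≤ (*-monoˡ-≤ κ (m≤m+n (count β P) (count β Q))))) ⟩
    κ + (weight e * κ + (count β P + count β Q) * κ) ≡⟨ lemma (weight e) (count β P + count β Q) κ ⟩
    (weight e + 1 + (count β P + count β Q)) * κ ∎) , q
    where
    open ≤-Reasoning
    lemma : ∀ w v k → k + (w * k + v * k) ≡ (w + 1 + v) * k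
    lemma = solve-∀

  -- I j is an invariant that holds when j iterations remain.
  run-loop : ∀ {i P s b} (I : ℕ → State → Set) → writesVar P i ≡ false →
             variables s i ≡ b → b ≤ β i → b ≤ N → 1 ≤ N → I b s →
             (∀ j s′ → j < b → KeepsVars (loop i P) s s′ → KeepsArrs (loop i P) s s′ →
              variables s′ i ≡ suc j → I (suc j) s′ → Run P (set i j s′) (I j)) →
             Run (loop i P) s (I 0)
  run-loop {i} {P} {s} {b} I w s≡b b≤β b≤N 1≤N I₀ step =
    let s′ , t , D , t≤ , q = go b s ≤-refl s≡b I₀ (λ _ _ → refl) (λ _ _ → refl) in
    s′ , t , D , ≤-trans t≤ (*-monoˡ-≤ κ (+-monoˡ-≤ (1 + 1) (*-monoˡ-≤ (1 + 1 + body) b≤β))) , q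
    where
    open ≤-Reasoning
    body = count β (i := binop sub (var i) (lit 1) ⨾ P)
    set-get : ∀ f v → (f [ i ↦ v ]) i ≡ v
    set-get f v with i ≡ᵇ i | ≡⇒≡ᵇ i i refl
    ... | true | _ = refl
    lemma : ∀ j c k → k + k + c * k + (j * (1 + 1 + c) + (1 + 1)) * k ≡ (suc j * (1 + 1 + c) + (1 + 1)) * k
    lemma = solve-∀
    go : ∀ j s₁ → j ≤ b → variables s₁ i ≡ j → I j s₁ → KeepsVars (loop i P) s s₁ →
         KeepsArrs (loop i P) s s₁ →
         ∃[ s′ ] ∃[ t ] ((loop i P ∶ s₁ ⇓ s′ within t) × t ≤ (j * (1 + 1 + body) + (1 + 1)) * κ × I 0 s′)
    go zero s₁ j≤b eq inv kv ka = s₁ , _ , ⇓stop eq ,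
      (begin
        _ ≤⟨ +-mono-≤ 1≤κ (cheap (ev-var {i} {s₁} eq z≤n)) ⟩
        κ + (κ + 0) ∎) , inv
    go (suc j) s₁ j<b eq inv kv ka
      with run-seq {Q = P} {R = λ s′ → Run P s′ (I j)} {T = I j}
             (run-assign {i} {binop sub (var i) (lit 1)} {s₁} {j} {λ s′ → Run P s′ (I j)}
               (ev-sub (ev-var {i} {s₁} eq (≤-trans j<b b≤N)) (ev-lit {1} 1≤N))
               (step j s₁ j<b kv ka eq inv))
             (λ _ _ _ r → r)
    -- The derivation is opened to isolate the body `D₂`, which by `w` keeps the counter, so that
    -- the decrement alone determines its value.
    ... | s₂ , t , D@(⇓seq ⇓assign D₂) , t≤ , inv₂
      with go j s₂ (<⇒≤ j<b)
             (trans (keepsVars D₂ i w) (trans (set-get (variables s₁) _) (cong (_∸ 1) eq)))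
             inv₂
             (λ y wy → trans (keepsVars D y wy) (kv y wy))
             (λ y wy → trans (keepsArrs D y wy) (ka y wy))
    ... | s₃ , u , D′ , u≤ , inv₃ =
      s₃ , _ , ⇓loop (λ z → contradiction (trans (sym z) eq) λ ()) D D′ , (begin
        _ ≤⟨ +-mono-≤ (+-mono-≤ (+-mono-≤ 1≤κ (cheap (ev-var {i} {s₁} eq (≤-trans j<b b≤N)))) t≤) u≤ ⟩
        κ + 1 * κ + body * κ + (j * (1 + 1 + body) + (1 + 1)) * κ
          ≡⟨ cong (λ z → κ + z + body * κ + (j * (1 + 1 + body) + (1 + 1)) * κ) (*-identityˡ κ) ⟩
        κ + κ + body * κ + (j * (1 + 1 + body) + (1 + 1)) * κ ≡⟨ lemma j body κ ⟩
        (suc j * (1 + 1 + body) + (1 + 1)) * κ ∎) , inv₃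

-- Finite sums and products

↦-same : ∀ {A : Set} (f : ℕ → A) i v → (f [ i ↦ v ]) i ≡ v
↦-same f i v with i ≡ᵇ i | ≡⇒≡ᵇ i i refl
... | true | _ = refl

↦-other : ∀ {A : Set} (f : ℕ → A) {i l} v → i ≢ l → (f [ i ↦ v ]) l ≡ f l
↦-other f {i} {l} v i≢l with i ≡ᵇ l | ≡ᵇ⇒≡ i l
... | false | _ = refl
... | true  | h = contradiction (h _) i≢l

∑< ∏< : ℕ → (ℕ → ℕ) → ℕ
∑< zero    f = 0
∑< (suc j) f = f j + ∑< j f
∏< zero    f = 1
∏< (suc j) f = f j * ∏< j f

∑-cong : ∀ j {f g} → (∀ i → i < j → f i ≡ g i) → ∑< j f ≡ ∑< j g
∑-cong zero    h = refl
∑-cong (suc j) h = cong₂ _+_ (h j ≤-refl) (∑-cong j λ i i<j → h i (m<n⇒m<1+n i<j))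

∑-mono : ∀ j {f g} → (∀ i → i < j → f i ≤ g i) → ∑< j f ≤ ∑< j g
∑-mono zero    h = z≤n
∑-mono (suc j) h = +-mono-≤ (h j ≤-refl) (∑-mono j λ i i<j → h i (m<n⇒m<1+n i<j))

∑-const : ∀ j b → ∑< j (λ _ → b) ≡ j * b
∑-const zero    b = refl
∑-const (suc j) b = cong (b +_) (∑-const j b)

∑-* : ∀ j h f → ∑< j (λ i → h * f i) ≡ h * ∑< j f
∑-* zero    h f = sym (*-zeroʳ h)
∑-* (suc j) h f = trans (cong (h * f j +_) (∑-* j h f)) (sym (*-distribˡ-+ h (f j) (∑< j f)))

∑-+ : ∀ j f g → ∑< j (λ i → f i + g i) ≡ ∑< j f + ∑< j g
∑-+ zero    f g = refl
∑-+ (suc j) f g = trans (cong (f j + g j +_) (∑-+ j f g)) (lemma (f j) (g j) _ _)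
  where
  lemma : ∀ a b c d → a + b + (c + d) ≡ a + c + (b + d)
  lemma = solve-∀

term≤∑ : ∀ {j i} f → i < j → f i ≤ ∑< j f
term≤∑ {suc j} {i} f i<1+j with m≤n⇒m<n∨m≡n i<1+j
... | inj₁ (s≤s i<j) = ≤-trans (term≤∑ f i<j) (m≤n+m _ (f j))
... | inj₂ refl      = m≤m+n (f j) _

∏-cong : ∀ j {f g} → (∀ i → i < j → f i ≡ g i) → ∏< j f ≡ ∏< j g
∏-cong zero    h = refl
∏-cong (suc j) h = cong₂ _*_ (h j ≤-refl) (∏-cong j λ i i<j → h i (m<n⇒m<1+n i<j))

∏-mono : ∀ j {f g} → (∀ i → i < j → f i ≤ g i) → ∏< j f ≤ ∏< j g
∏-mono zero    h = s≤s z≤n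
∏-mono (suc j) h = *-mono-≤ (h j ≤-refl) (∏-mono j λ i i<j → h i (m<n⇒m<1+n i<j))

∏-const : ∀ j b → ∏< j (λ _ → b) ≡ b ^ j
∏-const zero    b = refl
∏-const (suc j) b = cong (b *_) (∏-const j b)

∏-* : ∀ j f g → ∏< j (λ i → f i * g i) ≡ ∏< j f * ∏< j g
∏-* zero    f g = refl
∏-* (suc j) f g = trans (cong (f j * g j *_) (∏-* j f g)) (lemma (f j) (g j) _ _)
  where
  lemma : ∀ a b c d → a * b * (c * d) ≡ a * c * (b * d)
  lemma = solve-∀

∏-^ : ∀ j b f → ∏< j (λ i → b ^ f i) ≡ b ^ ∑< j f
∏-^ zero    b f = refl
∏-^ (suc j) b f = trans (cong (b ^ f j *_) (∏-^ j b f)) (sym (^-distribˡ-+-* b (f j) _))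

-- A product is linear in its factor `i`, the only one in which the functions `g c` may differ.
∏-expand : ∀ j {i} m f (g : ℕ → ℕ → ℕ) → i < j → (∀ l → l ≢ i → ∀ c → g c l ≡ f l) →
           f i ≡ ∑< m (λ c → g c i) → ∏< j f ≡ ∑< m (λ c → ∏< j (g c))
∏-expand (suc j) {i} m f g i<1+j other same with m≤n⇒m<n∨m≡n i<1+j
... | inj₁ (s≤s i<j) = begin
  f j * ∏< j f                          ≡⟨ cong (f j *_) (∏-expand j m f g i<j other same) ⟩
  f j * ∑< m (λ c → ∏< j (g c))         ≡⟨ ∑-* m (f j) _ ⟨
  ∑< m (λ c → f j * ∏< j (g c))
    ≡⟨ ∑-cong m (λ c _ → cong (_* ∏< j (g c)) (sym (other j (>⇒≢ i<j) c))) ⟩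
  ∑< m (λ c → g c j * ∏< j (g c))       ∎
  where open ≡-Reasoning
... | inj₂ refl = begin
  f j * ∏< j f                          ≡⟨ *-comm (f j) _ ⟩
  ∏< j f * f j                          ≡⟨ cong (∏< j f *_) same ⟩
  ∏< j f * ∑< m (λ c → g c j)           ≡⟨ ∑-* m (∏< j f) _ ⟨
  ∑< m (λ c → ∏< j f * g c j)
    ≡⟨ ∑-cong m (λ c _ → trans (*-comm _ (g c j)) (cong (g c j *_)
         (∏-cong j λ l l<j → sym (other l (<⇒≢ l<j) c)))) ⟩
  ∑< m (λ c → g c j * ∏< j (g c))       ∎
  where open ≡-Reasoning

-- Bit masks

-- The remainder is expressed by division and subtraction, the form in which the machine can compute
-- it.
half bit : ℕ → ℕ
half S = S / 2
bit S = S ∸ 2 * half S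

half-even : ∀ S → half (2 * S) ≡ S
half-even S = trans (cong half (*-comm 2 S)) (m*n/n≡m S 2)

half-odd : ∀ S → half (1 + 2 * S) ≡ S
half-odd S = ≤-antisym (≤-pred (*-cancelʳ-< 2 _ _ (begin-strict
    half (1 + 2 * S) * 2 ≤⟨ m/n*n≤m (1 + 2 * S) 2 ⟩
    1 + 2 * S            <⟨ n<1+n _ ⟩
    2 + 2 * S            ≡⟨ cong (2 +_) (*-comm 2 S) ⟩
    suc S * 2            ∎)))
  (≤-trans (≤-reflexive (sym (half-even S))) (/-monoˡ-≤ 2 (n≤1+n (2 * S))))
  where open ≤-Reasoning

bit-even : ∀ S → bit (2 * S) ≡ 0
bit-even S = trans (cong (λ H → 2 * S ∸ 2 * H) (half-even S)) (n∸n≡0 (2 * S))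

bit-odd : ∀ S → bit (1 + 2 * S) ≡ 1
bit-odd S = trans (cong (λ H → 1 + 2 * S ∸ 2 * H) (half-odd S)) (m+n∸n≡m 1 (2 * S))

bit≤1 : ∀ S → bit S ≤ 1
bit≤1 S = begin
  S ∸ 2 * half S                        ≡⟨ cong (_∸ 2 * half S) (m≡m%n+[m/n]*n S 2) ⟩
  S % 2 + half S * 2 ∸ 2 * half S       ≡⟨ cong (λ z → S % 2 + z ∸ 2 * half S) (*-comm (half S) 2) ⟩
  S % 2 + 2 * half S ∸ 2 * half S       ≡⟨ m+n∸n≡m (S % 2) (2 * half S) ⟩
  S % 2                                 ≤⟨ ≤-pred (m%n<n S 2) ⟩
  1                                     ∎
  where open ≤-Reasoning

flipUnless : ℕ → ℕ → ℕ
flipUnless zero    a = 1 ∸ a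
flipUnless (suc _) a = a

-- The parity of a plus the number of the x clients that are absent from S.
parity : ℕ → ℕ → ℕ → ℕ
parity zero    S a = a
parity (suc x) S a = parity x (half S) (flipUnless (bit S) a)

parity≤1 : ∀ x S {a} → a ≤ 1 → parity x S a ≤ 1
parity≤1 zero    S a≤1 = a≤1
parity≤1 (suc x) S {a} a≤1 = parity≤1 x (half S) (flip≤ (bit S))
  where
  flip≤ : ∀ b → flipUnless b a ≤ 1
  flip≤ zero    = m∸n≤m 1 a
  flip≤ (suc _) = a≤1

-- Parity is additive in its start value. Hence one computed parity tells to which of the two signed
-- sums a mask belongs.
parity-flip : ∀ x S {a} → a ≤ 1 → parity x S (1 ∸ a) ≡ 1 ∸ parity x S a
parity-flip zero    S a≤1 = refl
parity-flip (suc x) S {a} a≤1 with bit S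
... | zero  = parity-flip x (half S) (m∸n≤m 1 a)
... | suc _ = parity-flip x (half S) a≤1

ifZero : ℕ → ℕ → ℕ
ifZero zero    v = v
ifZero (suc _) v = 0

ifZero-* : ∀ a h v → ifZero a (h * v) ≡ h * ifZero a v
ifZero-* zero    h v = refl
ifZero-* (suc _) h v = sym (*-zeroʳ h)

ifZero-+ : ∀ a v w → ifZero a (v + w) ≡ ifZero a v + ifZero a w
ifZero-+ zero    v w = refl
ifZero-+ (suc _) v w = refl

-- Splits the masks by their lowest bit. That bit stands for the client of largest index, so `half`
-- leaves a mask of the remaining clients, which is what inductions over the number of clients need.
∑-halve : ∀ h f → ∑< (2 * h) f ≡ ∑< h (λ S → f (2 * S)) + ∑< h (λ S → f (1 + 2 * S))
∑-halve zero    f = refl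
∑-halve (suc h) f = begin
  ∑< (2 * suc h) f ≡⟨ cong (λ z → ∑< z f) (*-distribˡ-+ 2 1 h) ⟩
  f (1 + 2 * h) + (f (2 * h) + ∑< (2 * h) f)
    ≡⟨ cong (λ z → f (1 + 2 * h) + (f (2 * h) + z)) (∑-halve h f) ⟩
  f (1 + 2 * h) + (f (2 * h) + (∑< h (λ S → f (2 * S)) + ∑< h (λ S → f (1 + 2 * S))))
    ≡⟨ lemma (f (1 + 2 * h)) (f (2 * h)) _ _ ⟩
  f (2 * h) + ∑< h (λ S → f (2 * S)) + (f (1 + 2 * h) + ∑< h (λ S → f (1 + 2 * S))) ∎
  where
  open ≡-Reasoning
  lemma : ∀ a b c d → a + (b + (c + d)) ≡ b + c + (a + d)
  lemma = solve-∀

-- The sum of F over those subsets whose complement has size ≡ a (mod 2).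
∑± : ℕ → ℕ → (ℕ → ℕ) → ℕ
∑± n a F = ∑< (2 ^ n) (λ S → ifZero (parity n S a) (F S))

∑±-cong : ∀ n a {F G} → (∀ S → F S ≡ G S) → ∑± n a F ≡ ∑± n a G
∑±-cong n a h = ∑-cong (2 ^ n) λ S _ → cong (ifZero (parity n S a)) (h S)

∑±-* : ∀ n a h F → ∑± n a (λ S → h * F S) ≡ h * ∑± n a F
∑±-* n a h F = trans (∑-cong (2 ^ n) λ S _ → ifZero-* (parity n S a) h (F S))
                     (∑-* (2 ^ n) h _)

∑±-+ : ∀ n a F G → ∑± n a (λ S → F S + G S) ≡ ∑± n a F + ∑± n a G
∑±-+ n a F G = trans (∑-cong (2 ^ n) λ S _ → ifZero-+ (parity n S a) (F S) (G S))
                     (∑-+ (2 ^ n) _ _)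

∑±-suc : ∀ n a F → ∑± (suc n) a F ≡ ∑± n (1 ∸ a) (F ∘ (2 *_)) + ∑± n a (F ∘ (1 +_) ∘ (2 *_))
∑±-suc n a F = trans (∑-halve (2 ^ n) _) (cong₂ _+_
  (∑-cong (2 ^ n) λ S _ → cong (λ z → ifZero z (F (2 * S)))
    (cong₂ (λ h b → parity n h (flipUnless b a)) (half-even S) (bit-even S)))
  (∑-cong (2 ^ n) λ S _ → cong (λ z → ifZero z (F (1 + 2 * S)))
    (cong₂ (λ h b → parity n h (flipUnless b a)) (half-odd S) (bit-odd S))))

-- Σ_S (−1)^{n − |S|} F S = v, with the negative terms moved to the right.
Alternating : ℕ → (ℕ → ℕ) → ℕ → Set
Alternating n F v = ∑± n 0 F ≡ ∑± n 1 F + v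

alternating-cong : ∀ n {F G v} → (∀ S → F S ≡ G S) → Alternating n F v → Alternating n G v
alternating-cong n {v = v} h eq =
  trans (sym (∑±-cong n 0 h)) (trans eq (cong (_+ v) (∑±-cong n 1 h)))

alternating-∑ : ∀ n m {F : ℕ → ℕ → ℕ} {v} → (∀ c → c < m → Alternating n (F c) (v c)) →
                Alternating n (λ S → ∑< m (λ c → F c S)) (∑< m v)
alternating-∑ n zero h = sym (trans (+-identityʳ _) (trans (∑±-zero 1) (sym (∑±-zero 0))))
  where
  ∑±-zero : ∀ a → ∑± n a (λ _ → 0) ≡ 0
  ∑±-zero a = ∑±-* n a 0 (λ _ → 0)
alternating-∑ n (suc m) {F} {v} h = begin
  ∑± n 0 (λ S → F m S + ∑< m (λ c → F c S)) ≡⟨ ∑±-+ n 0 _ _ ⟩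
  ∑± n 0 (F m) + ∑± n 0 (λ S → ∑< m (λ c → F c S))
    ≡⟨ cong₂ _+_ (h m ≤-refl) (alternating-∑ n m λ c c<m → h c (m<n⇒m<1+n c<m)) ⟩
  ∑± n 1 (F m) + v m + (∑± n 1 (λ S → ∑< m (λ c → F c S)) + ∑< m v)
    ≡⟨ lemma (∑± n 1 (F m)) (v m) _ (∑< m v) ⟩
  ∑± n 1 (F m) + ∑± n 1 (λ S → ∑< m (λ c → F c S)) + (v m + ∑< m v)
    ≡⟨ cong (_+ (v m + ∑< m v)) (∑±-+ n 1 _ _) ⟨
  ∑± n 1 (λ S → F m S + ∑< m (λ c → F c S)) + (v m + ∑< m v) ∎
  where
  open ≡-Reasoning
  lemma : ∀ a b c d → a + b + (c + d) ≡ a + c + (b + d)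
  lemma = solve-∀

-- Inclusion-exclusion for a single client: its absence from S gives the factor b with a changed
-- sign, its presence gives b + g, and the difference g is what survives.
alternating-suc : ∀ n {F G v} b g → (∀ S → F (2 * S) ≡ b * G S) →
                  (∀ S → F (1 + 2 * S) ≡ (b + g) * G S) →
                  Alternating n G v → Alternating (suc n) F (g * v)
alternating-suc n {F} {G} {v} b g even odd eq = begin
  ∑± (suc n) 0 F                       ≡⟨ split 0 ⟩
  b * ∑± n 1 G + (b + g) * ∑± n 0 G    ≡⟨ cong (λ z → b * ∑± n 1 G + (b + g) * z) eq ⟩
  b * ∑± n 1 G + (b + g) * (∑± n 1 G + v)
    ≡⟨ lemma b g (∑± n 1 G) v ⟩
  b * (∑± n 1 G + v) + (b + g) * ∑± n 1 G + g * v
    ≡⟨ cong (λ z → b * z + (b + g) * ∑± n 1 G + g * v) eq ⟨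
  b * ∑± n 0 G + (b + g) * ∑± n 1 G + g * v ≡⟨ cong (_+ g * v) (split 1) ⟨
  ∑± (suc n) 1 F + g * v               ∎
  where
  open ≡-Reasoning
  split : ∀ a → ∑± (suc n) a F ≡ b * ∑± n (1 ∸ a) G + (b + g) * ∑± n a G
  split a = trans (∑±-suc n a F) (cong₂ _+_
    (trans (∑±-cong n (1 ∸ a) even) (∑±-* n (1 ∸ a) b G))
    (trans (∑±-cong n a odd) (∑±-* n a (b + g) G)))
  lemma : ∀ b g N v → b * N + (b + g) * (N + v) ≡ b * (N + v) + (b + g) * N + g * v
  lemma = solve-∀

-- Weighted covers

module Cover (m n k E : ℕ) (u : ℕ → ℕ → ℕ) where

  -- E stands for the cost 0 of leaving client x out of the cluster of c, and
  -- u c x for the cost of putting it in.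
  clusters : ℕ → ℕ → ℕ → ℕ
  clusters c zero    S = 1
  clusters c (suc x) S = (E + bit S * u c x) * clusters c x (half S)

  -- Π_{l<j} (E + u (a l) x) − E^j
  covered : ℕ → (ℕ → ℕ) → ℕ → ℕ
  covered zero    a x = 0
  covered (suc j) a x = E * covered j a x + u (a j) x * ∏< j (λ l → E + u (a l) x)

  covered-∏ : ∀ j a x → ∏< j (λ l → E + u (a l) x) ≡ ∏< j (λ _ → E) + covered j a x
  covered-∏ zero    a x = refl
  covered-∏ (suc j) a x = begin
    (E + u (a j) x) * ∏< j (λ l → E + u (a l) x)
      ≡⟨ *-distribʳ-+ _ E (u (a j) x) ⟩
    E * ∏< j (λ l → E + u (a l) x) + r
      ≡⟨ cong (λ z → E * z + r) (covered-∏ j a x) ⟩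
    E * (∏< j (λ _ → E) + covered j a x) + r
      ≡⟨ lemma E _ (covered j a x) r ⟩
    E * ∏< j (λ _ → E) + (E * covered j a x + r) ∎
    where
    open ≡-Reasoning
    r = u (a j) x * ∏< j (λ l → E + u (a l) x)
    lemma : ∀ E p c r → E * (p + c) + r ≡ E * p + (E * c + r)
    lemma = solve-∀

  covered-cong : ∀ j {a b} x → (∀ l → l < j → a l ≡ b l) → covered j a x ≡ covered j b x
  covered-cong zero    x h = refl
  covered-cong (suc j) x h = cong₂ _+_
    (cong (E *_) (covered-cong j x h′))
    (cong₂ _*_ (cong (λ c → u c x) (h j ≤-refl))
               (∏-cong j λ l l<j → cong (λ c → E + u c x) (h′ l l<j)))
    where
    h′ : ∀ l → l < j → _
    h′ l l<j = h l (m<n⇒m<1+n l<j)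

  -- With the centers of the slots l ≥ i fixed to a l, the total weight of all
  -- ways to choose the others.
  total : ℕ → (ℕ → ℕ) → ℕ
  total zero    a = ∏< n (covered k a)
  total (suc i) a = ∑< m (λ c → total i (a [ i ↦ c ]))

  total-cong : ∀ i {a b} → (∀ l → i ≤ l → l < k → a l ≡ b l) → total i a ≡ total i b
  total-cong zero    h = ∏-cong n λ x _ → covered-cong k x λ l l<k → h l z≤n l<k
  total-cong (suc i) {a} {b} h = ∑-cong m λ c _ → total-cong i (agree c)
    where
    agree : ∀ c l → i ≤ l → l < k → (a [ i ↦ c ]) l ≡ (b [ i ↦ c ]) l
    agree c l i≤l l<k with m≤n⇒m<n∨m≡n i≤l
    ... | inj₁ i<l = trans (↦-other a c (<⇒≢ i<l))
                           (trans (h l i<l l<k) (sym (↦-other b c (<⇒≢ i<l))))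
    ... | inj₂ refl = trans (↦-same a i c) (sym (↦-same b i c))

  total-step : ∀ i a {c} → c < m → total i (a [ i ↦ c ]) ≤ total (suc i) a
  total-step i a = term≤∑ (λ c → total i (a [ i ↦ c ]))

  -- The tuple `a` is itself among the tuples summed, and all weights are non-negative.
  total-≤ : ∀ i {a} → (∀ l → l < i → a l < m) → total 0 a ≤ total i a
  total-≤ zero    h = ≤-refl
  total-≤ (suc i) {a} h = begin
    total 0 a             ≤⟨ total-≤ i (λ l l<i → h l (m<n⇒m<1+n l<i)) ⟩
    total i a             ≡⟨ total-cong i agree ⟩
    total i (a [ i ↦ a i ]) ≤⟨ total-step i a (h i ≤-refl) ⟩
    total (suc i) a       ∎
    where
    open ≤-Reasoning
    agree : ∀ l → i ≤ l → l < k → a l ≡ (a [ i ↦ a i ]) l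
    agree l i≤l l<k with m≤n⇒m<n∨m≡n i≤l
    ... | inj₁ i<l  = sym (↦-other a (a i) (<⇒≢ i<l))
    ... | inj₂ refl = sym (↦-same a i (a i))

  -- With every slot fixed the product over slots factors over the clients. Peeling off client `x`
  -- is `alternating-suc` with b = E^k, the case that no slot takes `x`, and g = `covered k a x`.
  total-fixed : ∀ a → Alternating n (λ S → ∏< k (λ l → clusters (a l) n S)) (total 0 a)
  total-fixed a = go n
    where
    open ≡-Reasoning
    go : ∀ x → Alternating x (λ S → ∏< k (λ l → clusters (a l) x S)) (∏< x (covered k a))
    go zero    = trans (+-identityʳ _) (trans (∏-const k 1) (^-zeroˡ k))
    go (suc x) = alternating-suc x (∏< k (λ _ → E)) (covered k a x)
      (λ S → trans (∏-* k _ _) (cong₂ _*_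
        (∏-cong k λ l _ → trans (cong (λ b → E + b * u (a l) x) (bit-even S)) (+-identityʳ E))
        (∏-cong k λ l _ → cong (clusters (a l) x) (half-even S))))
      (λ S → trans (∏-* k _ _) (cong₂ _*_
        (trans (∏-cong k λ l _ → cong (E +_)
                 (trans (cong (_* u (a l) x) (bit-odd S)) (*-identityˡ (u (a l) x))))
               (covered-∏ k a x))
        (∏-cong k λ l _ → cong (clusters (a l) x) (half-odd S))))
      (go x)

  -- The slot l ranges over all centers if i ∸ l > 0, and is fixed otherwise.
  first width : ℕ → ℕ → ℕ
  first zero    c = c
  first (suc _) c = 0
  width zero    c = 1
  width (suc _) c = m

  -- A fixed slot is treated as a range of length one, so that the same loop evaluates fixed and
  -- free slots.
  slot : ℕ → (ℕ → ℕ) → ℕ → ℕ → ℕ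
  slot i a l S = ∑< (width (i ∸ l) (a l)) (λ j → clusters (first (i ∸ l) (a l) + j) n S)

  slot-fixed : ∀ {i l} a S → i ≤ l → slot i a l S ≡ clusters (a l) n S
  slot-fixed {i} {l} a S i≤l with i ∸ l | m≤n⇒m∸n≡0 i≤l
  ... | zero | _ = trans (+-identityʳ _) (cong (λ c → clusters c n S) (+-identityʳ (a l)))

  slot-free : ∀ {i l} a S → l < i → slot i a l S ≡ ∑< m (λ c → clusters c n S)
  slot-free {i} {l} a S l<i with i ∸ l | m<n⇒0<n∸m l<i
  ... | suc _ | _ = refl

  slots : ℕ → (ℕ → ℕ) → ℕ → ℕ
  slots i a S = ∏< k (λ l → slot i a l S)

  -- Freeing slot `i` replaces one factor by its sum over all centers. By multilinearity and the
  -- linearity of `Alternating`, the values for the individual centers add up, as they do in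
  -- `total`.
  slots-alternating : ∀ i a → i ≤ k → Alternating n (slots i a) (total i a)
  slots-alternating zero    a i≤k = alternating-cong n
    (λ S → ∏-cong k λ l _ → sym (slot-fixed a S z≤n)) (total-fixed a)
  slots-alternating (suc i) a i<k = alternating-cong n
    (λ S → sym (∏-expand k m _ (λ c l → slot i (a [ i ↦ c ]) l S) i<k (other S)
      (trans (slot-free {l = i} a S ≤-refl) (∑-cong m λ c _ →
        sym (trans (slot-fixed (a [ i ↦ c ]) S ≤-refl)
                   (cong (λ c → clusters c n S) (↦-same a i c)))))))
    (alternating-∑ n m λ c _ → slots-alternating i (a [ i ↦ c ]) (<⇒≤ i<k))
    where
    other : ∀ S l → l ≢ i → ∀ c → slot i (a [ i ↦ c ]) l S ≡ slot (suc i) a l S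
    other S l l≢i c with <-cmp l i
    ... | tri< l<i _ _ = trans (slot-free (a [ i ↦ c ]) S l<i) (sym (slot-free a S (m<n⇒m<1+n l<i)))
    ... | tri≈ _ l≡i _ = contradiction l≡i l≢i
    ... | tri> _ _ i<l = trans (slot-fixed (a [ i ↦ c ]) S (<⇒≤ i<l))
      (trans (cong (λ c → clusters c n S) (↦-other a c (<⇒≢ i<l))) (sym (slot-fixed a S i<l)))

  module _ (E≥1 : 1 ≤ E) where

    clusters≥1 : ∀ c x S → 1 ≤ clusters c x S
    clusters≥1 c zero    S = ≤-refl
    clusters≥1 c (suc x) S =
      *-mono-≤ (≤-trans E≥1 (m≤m+n E _)) (clusters≥1 c x (half S))

    slot≥1 : 1 ≤ m → ∀ i a l S → 1 ≤ slot i a l S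
    slot≥1 1≤m i a l S = ≤-trans (clusters≥1 _ n S) (term≤∑ (λ j → clusters (first (i ∸ l) (a l) + j) n S) (pos (i ∸ l)))
      where
      pos : ∀ d → 0 < width d (a l)
      pos zero    = s≤s z≤n
      pos (suc _) = 1≤m

  module _ {A} (E+u≤A : ∀ c x → E + u c x ≤ A) where

    clusters≤ : ∀ c x S → clusters c x S ≤ A ^ x
    clusters≤ c zero    S = ≤-refl
    clusters≤ c (suc x) S = *-mono-≤
      (≤-trans (+-monoʳ-≤ E (≤-trans (*-monoˡ-≤ (u c x) (bit≤1 S)) (≤-reflexive (*-identityˡ (u c x))))) (E+u≤A c x))
      (clusters≤ c x (half S))

    slot≤ : 1 ≤ m → ∀ i a l S → slot i a l S ≤ m * A ^ n
    slot≤ 1≤m i a l S = begin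
      slot i a l S ≤⟨ ∑-mono (width (i ∸ l) (a l)) (λ j _ → clusters≤ _ n S) ⟩
      ∑< (width (i ∸ l) (a l)) (λ _ → A ^ n) ≡⟨ ∑-const (width (i ∸ l) (a l)) (A ^ n) ⟩
      width (i ∸ l) (a l) * A ^ n ≤⟨ *-monoˡ-≤ (A ^ n) (width≤ (i ∸ l)) ⟩
      m * A ^ n ∎
      where
      open ≤-Reasoning
      width≤ : ∀ d → width d (a l) ≤ m
      width≤ zero    = 1≤m
      width≤ (suc _) = ≤-refl

    slots≤ : 1 ≤ m → ∀ i a S → slots i a S ≤ (m * A ^ n) ^ k
    slots≤ 1≤m i a S = ≤-trans (∏-mono k λ l _ → slot≤ 1≤m i a l S) (≤-reflexive (∏-const k _))

  -- Of the expanded product, only the term in which slot `l` alone covers `x` is kept. The extra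
  -- factor E on the right avoids the exponent j - 1.
  covered-≥ : ∀ j a {l} x → l < j → E ^ j * u (a l) x ≤ E * covered j a x
  covered-≥ (suc j) a {l} x l<1+j with m≤n⇒m<n∨m≡n l<1+j
  ... | inj₁ (s≤s l<j) = begin
    E * E ^ j * u (a l) x     ≡⟨ *-assoc E _ _ ⟩
    E * (E ^ j * u (a l) x)   ≤⟨ *-monoʳ-≤ E (covered-≥ j a x l<j) ⟩
    E * (E * covered j a x)   ≤⟨ *-monoʳ-≤ E (m≤m+n _ _) ⟩
    E * covered (suc j) a x   ∎
    where open ≤-Reasoning
  ... | inj₂ refl = begin
    E * E ^ j * u (a j) x     ≡⟨ lemma E (E ^ j) _ ⟩
    E * (u (a j) x * E ^ j)   ≤⟨ *-monoʳ-≤ E (*-monoʳ-≤ (u (a j) x) (begin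
      E ^ j                         ≡⟨ ∏-const j E ⟨
      ∏< j (λ _ → E)                ≤⟨ ∏-mono j (λ l _ → m≤m+n E _) ⟩
      ∏< j (λ l → E + u (a l) x)    ∎)) ⟩
    E * (u (a j) x * ∏< j (λ l → E + u (a l) x)) ≤⟨ *-monoʳ-≤ E (m≤n+m _ _) ⟩
    E * covered (suc j) a x   ∎
    where
    open ≤-Reasoning
    lemma : ∀ E e u → E * e * u ≡ E * (u * e)
    lemma = solve-∀

  -- The expansion has fewer than 2^j terms with at least one u. In each of them one u is at most U,
  -- and the other factors are at most E because U ≤ E.
  covered-≤ : ∀ j a x {U} → U ≤ E → (∀ l → l < j → u (a l) x ≤ U) →
              E * covered j a x ≤ 2 ^ j * E ^ j * U
  covered-≤ zero    a x U≤E h = ≤-trans (≤-reflexive (*-zeroʳ E)) z≤n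
  covered-≤ (suc j) a x {U} U≤E h = begin
    E * (E * covered j a x + u (a j) x * ∏< j (λ l → E + u (a l) x))
      ≤⟨ *-monoʳ-≤ E (+-mono-≤ (covered-≤ j a x U≤E h′) (*-mono-≤ (h j ≤-refl) (begin
           ∏< j (λ l → E + u (a l) x) ≤⟨ ∏-mono j (λ l l<j → +-monoʳ-≤ E (≤-trans (h′ l l<j) U≤E)) ⟩
           ∏< j (λ _ → E + E)         ≡⟨ ∏-const j (E + E) ⟩
           (E + E) ^ j                ≡⟨ cong (_^ j) (cong (E +_) (sym (+-identityʳ E))) ⟩
           (2 * E) ^ j                ≡⟨ ^-distribʳ-* 2 E j ⟩
           2 ^ j * E ^ j              ∎))) ⟩
    E * (2 ^ j * E ^ j * U + U * (2 ^ j * E ^ j)) ≡⟨ lemma E (2 ^ j) (E ^ j) U ⟩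
    2 ^ suc j * E ^ suc j * U ∎
    where
    open ≤-Reasoning
    h′ : ∀ l → l < j → u (a l) x ≤ U
    h′ l l<j = h l (m<n⇒m<1+n l<j)
    lemma : ∀ E t e U → E * (t * e * U + U * (t * e)) ≡ 2 * t * (E * e) * U
    lemma = solve-∀
    ^-distribʳ-* : ∀ a b j → (a * b) ^ j ≡ a ^ j * b ^ j
    ^-distribʳ-* a b j = trans (sym (∏-const j (a * b)))
      (trans (∏-* j (λ _ → a) (λ _ → b)) (cong₂ _*_ (∏-const j a) (∏-const j b)))

-- From weights to costs

n<2^n : ∀ n → n < 2 ^ n
n<2^n zero    = s≤s z≤n
n<2^n (suc n) = begin
  2 + n           ≡⟨ +-suc 1 n ⟨
  1 + suc n       ≤⟨ +-mono-≤ (≤-trans (s≤s z≤n) (n<2^n n)) (n<2^n n) ⟩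
  2 ^ n + 2 ^ n   ≡⟨ cong (2 ^ n +_) (+-identityʳ (2 ^ n)) ⟨
  2 ^ suc n       ∎
  where open ≤-Reasoning

module Scale (m n k D : ℕ) (dist : ℕ → ℕ → ℕ) (k≤m : k ≤ m) where

  -- Chosen so that a change of the cost by 1 outweighs the number m^k of center
  -- tuples together with the error factor 2^(kn) of the weights.
  μ : ℕ
  μ = 1 + (m * n + m * m)

  E : ℕ
  E = 2 ^ (μ * D)

  u : ℕ → ℕ → ℕ
  u c x = 2 ^ (μ * (D ∸ dist c x))

  u-mono : ∀ {c c′ x} → dist c x ≤ dist c′ x → u c′ x ≤ u c x
  u-mono h = ^-monoʳ-≤ 2 (*-monoʳ-≤ μ (∸-monoʳ-≤ D h))

  u≤E : ∀ c x → u c x ≤ E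
  u≤E c x = ^-monoʳ-≤ 2 (*-monoʳ-≤ μ (m∸n≤m D (dist c x)))

  open Cover m n k E u public

  -- Applies `covered-≥` to every client with the slot `g x`; the factor `E ^ n` collects the E that
  -- each application needs.
  total-≥ : ∀ c (g : ℕ → ℕ) → (∀ x → x < n → g x < k) →
            (E ^ k) ^ n * 2 ^ (μ * ∑< n (λ x → D ∸ dist (c (g x)) x)) ≤ E ^ n * total 0 c
  total-≥ c g g<k = begin
    (E ^ k) ^ n * 2 ^ (μ * ∑< n gain) ≡⟨ cong₂ _*_ (∏-const n (E ^ k))
                                       (trans (∏-^ n 2 (λ x → μ * gain x)) (cong (2 ^_) (∑-* n μ gain))) ⟨
    ∏< n (λ _ → E ^ k) * ∏< n (λ x → u (c (g x)) x) ≡⟨ ∏-* n _ _ ⟨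
    ∏< n (λ x → E ^ k * u (c (g x)) x) ≤⟨ ∏-mono n (λ x x<n → covered-≥ k c x (g<k x x<n)) ⟩
    ∏< n (λ x → E * covered k c x) ≡⟨ ∏-* n _ _ ⟩
    ∏< n (λ _ → E) * total 0 c ≡⟨ cong (_* total 0 c) (∏-const n E) ⟩
    E ^ n * total 0 c ∎
    where
    open ≤-Reasoning
    gain : ℕ → ℕ
    gain x = D ∸ dist (c (g x)) x

  -- The nearest center of a client has the largest u, which therefore serves as `U` in `covered-≤`.
  total-≤-nearest : ∀ a (g : ℕ → ℕ) → (∀ x l → x < n → l < k → dist (a (g x)) x ≤ dist (a l) x) →
            E ^ n * total 0 a ≤ 2 ^ (k * n) * ((E ^ k) ^ n * 2 ^ (μ * ∑< n (λ x → D ∸ dist (a (g x)) x)))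
  total-≤-nearest a g nearest = begin
    E ^ n * total 0 a ≡⟨ cong (_* total 0 a) (∏-const n E) ⟨
    ∏< n (λ _ → E) * total 0 a ≡⟨ ∏-* n _ _ ⟨
    ∏< n (λ x → E * covered k a x)
      ≤⟨ ∏-mono n (λ x x<n → covered-≤ k a x (u≤E (a (g x)) x) λ l l<k → u-mono {a (g x)} {a l} (nearest x l x<n l<k)) ⟩
    ∏< n (λ x → 2 ^ k * E ^ k * u (a (g x)) x) ≡⟨ ∏-* n _ _ ⟩
    ∏< n (λ x → 2 ^ k * E ^ k) * ∏< n (λ x → u (a (g x)) x) ≡⟨ cong₂ _*_
        (trans (∏-* n _ _) (cong₂ _*_ (trans (∏-const n (2 ^ k)) (^-*-assoc 2 k n)) (∏-const n (E ^ k))))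
        (trans (∏-^ n 2 (λ x → μ * gain x)) (cong (2 ^_) (∑-* n μ gain))) ⟩
    2 ^ (k * n) * (E ^ k) ^ n * 2 ^ (μ * ∑< n gain) ≡⟨ *-assoc (2 ^ (k * n)) _ _ ⟩
    2 ^ (k * n) * ((E ^ k) ^ n * 2 ^ (μ * ∑< n gain)) ∎
    where
    open ≤-Reasoning
    gain : ℕ → ℕ
    gain x = D ∸ dist (a (g x)) x

  private
    ∑-gain : ∀ (h : ℕ → ℕ) → (∀ x → x < n → h x ≤ D) → ∑< n (λ x → D ∸ h x) + ∑< n h ≡ n * D
    ∑-gain h h≤D = trans (sym (∑-+ n _ _))
      (trans (∑-cong n λ x x<n → m∸n+n≡m (h≤D x x<n)) (∑-const n D))

  -- The two tuples are compared by their gains `A` and `A*`, the sums of D minus distance. The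
  -- greedy loss m^k ≤ 2^(mk) and the weight error 2^(kn) give μA ≤ mk + kn + μA*. As mk + kn < μ
  -- and gains are integers, A ≤ A*; gain and cost add up to nD for either tuple.
  optimal : ∀ a₀ a c (g g′ : ℕ → ℕ) →
            total k a₀ ≤ m ^ k * total 0 a →
            (∀ x l → x < n → l < k → dist (a (g x)) x ≤ dist (a l) x) →
            (∀ x → x < n → dist (a (g x)) x ≤ D) →
            (∀ l → l < k → c l < m) → (∀ x → x < n → g′ x < k) →
            (∀ x → x < n → dist (c (g′ x)) x ≤ D) →
            ∑< n (λ x → dist (a (g x)) x) ≤ ∑< n (λ x → dist (c (g′ x)) x)
  optimal a₀ a c g g′ good nearest a≤D c<m g′<k c≤D =
    +-cancelˡ-≤ A _ _ (begin
      A + costₐ   ≤⟨ +-monoˡ-≤ costₐ A≤A* ⟩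
      A* + costₐ  ≡⟨ ∑-gain _ a≤D ⟩
      n * D       ≡⟨ ∑-gain _ c≤D ⟨
      A + _       ∎)
    where
    open ≤-Reasoning
    costₐ = ∑< n (λ x → dist (a (g x)) x)
    A  = ∑< n (λ x → D ∸ dist (c (g′ x)) x)
    A* = ∑< n (λ x → D ∸ dist (a (g x)) x)
    W = (E ^ k) ^ n
    instance
      E≢0 : NonZero E
      E≢0 = m^n≢0 2 (μ * D)
      W≢0 : NonZero W
      W≢0 = m^n≢0 (E ^ k) n {{m^n≢0 E k}}
    lemma₁ : ∀ e M t → e * (M * t) ≡ M * (e * t)
    lemma₁ = solve-∀
    lemma₂ : ∀ M t W p → M * (t * (W * p)) ≡ W * (M * t * p)
    lemma₂ = solve-∀
    weights : 2 ^ (μ * A) ≤ 2 ^ (m * k + k * n + μ * A*)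
    weights = *-cancelˡ-≤ W (begin
      W * 2 ^ (μ * A)         ≤⟨ total-≥ c g′ g′<k ⟩
      E ^ n * total 0 c       ≤⟨ *-monoʳ-≤ (E ^ n) (begin
        total 0 c                 ≤⟨ total-≤ k c<m ⟩
        -- With all slots free, no entry of the given tuple matters.
        total k c                 ≡⟨ total-cong k (λ l k≤l l<k → contradiction l<k (≤⇒≯ k≤l)) ⟩
        total k a₀                ≤⟨ good ⟩
        m ^ k * total 0 a         ∎) ⟩
      E ^ n * (m ^ k * total 0 a) ≡⟨ lemma₁ (E ^ n) (m ^ k) _ ⟩
      m ^ k * (E ^ n * total 0 a) ≤⟨ *-mono-≤ (^-monoˡ-≤ k (<⇒≤ (n<2^n m))) (total-≤-nearest a g nearest) ⟩
      (2 ^ m) ^ k * (2 ^ (k * n) * (W * 2 ^ (μ * A*))) ≡⟨ lemma₂ ((2 ^ m) ^ k) (2 ^ (k * n)) W _ ⟩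
      W * ((2 ^ m) ^ k * 2 ^ (k * n) * 2 ^ (μ * A*)) ≡⟨ cong (W *_) (trans
          (cong (_* 2 ^ (μ * A*)) (trans (cong (_* 2 ^ (k * n)) (^-*-assoc 2 m k)) (sym (^-distribˡ-+-* 2 (m * k) (k * n)))))
          (sym (^-distribˡ-+-* 2 (m * k + k * n) (μ * A*)))) ⟩
      W * 2 ^ (m * k + k * n + μ * A*) ∎)
    error<μ : m * k + k * n < μ
    error<μ = s≤s (begin
      m * k + k * n ≤⟨ +-mono-≤ (*-monoʳ-≤ m k≤m) (*-monoˡ-≤ n k≤m) ⟩
      m * m + m * n ≡⟨ +-comm (m * m) (m * n) ⟩
      m * n + m * m ∎)
    A≤A* : A ≤ A*
    A≤A* = ≤-pred (*-cancelˡ-< μ _ _ (begin-strict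
      μ * A                   ≤⟨ 2^-cancel weights ⟩
      m * k + k * n + μ * A*  <⟨ +-monoˡ-< (μ * A*) error<μ ⟩
      μ + μ * A*              ≡⟨ *-suc μ A* ⟨
      μ * suc A*              ∎))
      where
      2^-cancel : ∀ {a b} → 2 ^ a ≤ 2 ^ b → a ≤ b
      2^-cancel {a} {b} h with a ≤? b
      ... | yes a≤b = a≤b
      ... | no  a≰b = contradiction h (<⇒≱ (^-monoʳ-< 2 (s≤s (s≤s z≤n)) (≰⇒> a≰b)))

-- The program

pattern vm     = 0
pattern vn     = 1
pattern vD     = 2
pattern vμ     = 3
pattern vE     = 4
pattern vk     = 5
pattern vi     = 6
pattern vc     = 7
pattern vbest  = 8
pattern vbestc = 9
pattern vS     = 10
pattern vT     = 11
pattern vpar   = 12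
pattern vpos   = 13
pattern vneg   = 14
pattern vl     = 15
pattern vprod  = 16
pattern vsum   = 17
pattern vcc    = 18
pattern vcnt   = 19
pattern vfirst = 20
pattern vcl    = 21
pattern vx     = 22
pattern ve     = 23
pattern vpow   = 24
pattern vnear  = 25

infixl 21 _⊕_ _⊖_
infixl 22 _⊗_

_⊕_ _⊖_ _⊗_ : Expr → Expr → Expr
_⊕_ = binop add
_⊖_ = binop sub
_⊗_ = binop mul

halfE bitE : Expr
halfE = binop div (var vT) (lit 2)
bitE  = var vT ⊖ lit 2 ⊗ halfE

-- Row n + c (facility c) and column x (client x) of the matrix, which starts in cell 2.
distE : Expr → Expr → Expr
distE c x = 0 [ lit 2 ⊕ ((var vn ⊕ c) ⊗ (var vn ⊕ var vm) ⊕ x) ]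

-- The tuple is kept where the output needs it: cell 0 of array 1 is reserved for `r`, the centers
-- follow, and after them the clusters.
centerE : Expr → Expr
centerE l = 1 [ lit 1 ⊕ l ]

powerP clusterStepP clustersP slotStepP slotP selectP slotsStepP slotsP : Program
parityStepP parityP totalStepP totalP trialP chooseP centersP compareP : Program
nearestP assignP solveP : Program

-- Repeated doubling is affordable, since every exponent it is used for is at most μ * D + n.
powerP = vpow := lit 1 ⨾ loop ve (vpow := var vpow ⊕ var vpow)

clusterStepP =
  ve := var vμ ⊗ (var vD ⊖ distE (var vcc) (var vx)) ⨾
  powerP ⨾
  vcl := (var vE ⊕ bitE ⊗ var vpow) ⊗ var vcl ⨾
  vT := halfE

clustersP = vT := var vS ⨾ vcl := lit 1 ⨾ vx := var vn ⨾ loop vx clusterStepP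

slotStepP = vcc := var vfirst ⊕ var vcnt ⨾ clustersP ⨾ vsum := var vcl ⊕ var vsum

slotP = vsum := lit 0 ⨾ loop vcnt slotStepP

selectP =
  ifNonZero (var vi ⊖ var vl)
    (vfirst := lit 0 ⨾ vcnt := var vm)
    (vfirst := centerE (var vl) ⨾ vcnt := lit 1)

slotsStepP = selectP ⨾ slotP ⨾ vprod := var vsum ⊗ var vprod

slotsP = vprod := lit 1 ⨾ vl := var vk ⨾ loop vl slotsStepP

parityStepP = ifNonZero bitE skip (vpar := lit 1 ⊖ var vpar) ⨾ vT := halfE

parityP = vT := var vS ⨾ vpar := lit 0 ⨾ vx := var vn ⨾ loop vx parityStepP

totalStepP =
  parityP ⨾ slotsP ⨾
  ifNonZero (var vpar) (vneg := var vprod ⊕ var vneg) (vpos := var vprod ⊕ var vpos)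

totalP =
  vpos := lit 0 ⨾ vneg := lit 0 ⨾ ve := var vn ⨾ powerP ⨾ vS := var vpow ⨾
  loop vS totalStepP

-- The candidate is written into slot `vi` itself, which then counts as fixed, since `selectP` frees
-- only the slots below `vi`.
trialP =
  1 [ lit 1 ⊕ var vi ]:= var vc ⨾
  totalP ⨾
  ifNonZero (var vpos ⊖ var vneg ⊖ var vbest)
    (vbest := var vpos ⊖ var vneg ⨾ vbestc := var vc)
    skip

chooseP =
  vbest := lit 0 ⨾ vbestc := lit 0 ⨾ vc := var vm ⨾ loop vc trialP ⨾
  1 [ lit 1 ⊕ var vi ]:= var vbestc

centersP = vi := var vk ⨾ loop vi chooseP

compareP =
  ifNonZero (distE (centerE (var vnear)) (var vx) ⊖ distE (centerE (var vl)) (var vx))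
    (vnear := var vl)
    skip

nearestP =
  vnear := lit 0 ⨾ vl := var vk ⨾ loop vl compareP ⨾
  1 [ lit 1 ⊕ (var vk ⊕ var vx) ]:= var vnear

assignP = vx := var vn ⨾ loop vx nearestP

solveP = centersP ⨾ assignP ⨾ 1 [ lit 0 ]:= var vk

compile : Poly → Expr
compile (con c)  = lit c
compile 𝑚        = var vm
compile 𝑛        = var vn
compile (p :+ q) = compile p ⊕ compile q
compile (p :* q) = compile p ⊗ compile q

-- Dominates every subterm; p itself need not, since a factor may vanish.
majorant : Poly → Poly
majorant (p :+ q) = majorant p :+ majorant q :+ (p :+ q)
majorant (p :* q) = majorant p :+ majorant q :+ (p :* q)
majorant p        = p

digitStepP readP : Program

digitStepP =
  vk := lit 2 ⊗ var vk ⊕ (0 [ lit 2 ⊕ ((var vn ⊕ var vm) ⊗ (var vn ⊕ var vm) ⊕ var vl) ])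

-- Horner's rule on digits m - 1 down to 0. The final assignment is a minimum with `vm`, obtained
-- from truncated subtraction as h ∸ (h ∸ m).
readP = vk := lit 0 ⨾ vl := var vm ⨾ loop vl digitStepP ⨾ vk := var vk ⊖ (var vk ⊖ var vm)

initP program : Poly → Program

initP p =
  vm := (0 [ lit 0 ]) ⨾
  vn := (0 [ lit 1 ]) ⨾
  vD := compile p ⨾
  vμ := lit 1 ⊕ (var vm ⊗ var vn ⊕ var vm ⊗ var vm) ⨾
  ve := var vμ ⊗ var vD ⨾
  powerP ⨾
  vE := var vpow ⨾
  readP

program p = initP p ⨾ solveP

-- Correctness and memory bounds of the program

module Verify (m n k D N : ℕ) (inp : ℕ → ℕ) (k≤m : k ≤ m) where

  dist : ℕ → ℕ → ℕ
  dist c x = inp (2 + ((n + c) * (n + m) + x))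

  open Scale m n k D dist k≤m public

  -- Masks, clients and exponents have bounds of their own; every other counter runs over slots,
  -- centers or digits, of which there are at most m.
  β : ℕ → ℕ
  β = (((λ _ → m) [ vS ↦ 2 ^ n ]) [ vx ↦ n ]) [ ve ↦ μ * D + n ]

  open Machine N β public

  A : ℕ
  A = 2 * E

  module _
    (1≤k     : 1 ≤ k)
    (dist≤D  : ∀ {c x} → c < m → x < n → dist c x ≤ D)
    (addr≤N  : 2 + ((n + m) * (n + m) + (n + m)) ≤ N)
    (μ≤N     : μ ≤ N)
    (μD≤N    : μ * D ≤ N)
    (2^n≤N   : 2 ^ n ≤ N)
    (A≤N     : A ≤ N)
    (slot≤N  : m * A ^ n ≤ N)
    (slots≤N : 2 ^ n * (m * A ^ n) ^ k ≤ N)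
    where

    1≤m : 1 ≤ m
    1≤m = ≤-trans 1≤k k≤m

    2≤N : 2 ≤ N
    2≤N = ≤-trans (m≤m+n 2 _) addr≤N

    1≤N : 1 ≤ N
    1≤N = <⇒≤ 2≤N

    2+n+m≤N : 2 + (n + m) ≤ N
    2+n+m≤N = ≤-trans (+-monoʳ-≤ 2 (m≤n+m (n + m) ((n + m) * (n + m)))) addr≤N

    n+m≤N : n + m ≤ N
    n+m≤N = ≤-trans (m≤n+m _ 2) 2+n+m≤N

    n≤N : n ≤ N
    n≤N = ≤-trans (m≤m+n n m) n+m≤N

    m≤N : m ≤ N
    m≤N = ≤-trans (m≤n+m m n) n+m≤N

    k≤N : k ≤ N
    k≤N = ≤-trans k≤m m≤N

    D≤N : D ≤ N
    D≤N = ≤-trans (m≤n*m D μ) μD≤N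

    E≤N : E ≤ N
    E≤N = ≤-trans (m≤m+n E (E + 0)) A≤N

    E≥1 : 1 ≤ E
    E≥1 = m^n>0 2 (μ * D)

    E+u≤A : ∀ c x → E + u c x ≤ A
    E+u≤A c x = +-monoʳ-≤ E (≤-trans (u≤E c x) (≤-reflexive (sym (+-identityʳ E))))

    clusters≤N : ∀ c S → clusters c n S ≤ N
    clusters≤N c S = begin
      clusters c n S  ≤⟨ clusters≤ E+u≤A c n S ⟩
      A ^ n           ≤⟨ m≤n*m (A ^ n) m {{>-nonZero 1≤m}} ⟩
      m * A ^ n       ≤⟨ slot≤N ⟩
      N               ∎
      where open ≤-Reasoning

    slots≤N′ : ∀ i a S → slots i a S ≤ N
    slots≤N′ i a S = begin
      slots i a S               ≤⟨ slots≤ E+u≤A 1≤m i a S ⟩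
      (m * A ^ n) ^ k           ≤⟨ m≤n*m _ (2 ^ n) {{m^n≢0 2 n}} ⟩
      2 ^ n * (m * A ^ n) ^ k   ≤⟨ slots≤N ⟩
      N                         ∎
      where open ≤-Reasoning

    ∑±≤N : ∀ i a b → ∑± n b (slots i a) ≤ N
    ∑±≤N i a b = begin
      ∑± n b (slots i a) ≤⟨ ∑-mono (2 ^ n) (λ S _ → ≤-trans (ifZero≤ (parity n S b) _) (slots≤ E+u≤A 1≤m i a S)) ⟩
      ∑< (2 ^ n) (λ _ → (m * A ^ n) ^ k) ≡⟨ ∑-const (2 ^ n) _ ⟩
      2 ^ n * (m * A ^ n) ^ k            ≤⟨ slots≤N ⟩
      N                                  ∎
      where
      open ≤-Reasoning
      ifZero≤ : ∀ b v → ifZero b v ≤ v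
      ifZero≤ zero    v = ≤-refl
      ifZero≤ (suc _) v = z≤n

    Env : State → Set
    Env s = variables s vm ≡ m × variables s vn ≡ n × variables s vD ≡ D ×
            variables s vμ ≡ μ × variables s vE ≡ E × variables s vk ≡ k ×
            (∀ i → arrays s 0 i ≡ inp i)

    touchesEnv : Program → Bool
    touchesEnv P =
      writesVar P vm ∨ writesVar P vn ∨ writesVar P vD ∨ writesVar P vμ ∨ writesVar P vE ∨
      writesVar P vk ∨ writesArr P 0

    keepsEnv : ∀ P {s s′} → touchesEnv P ≡ false → KeepsVars P s s′ → KeepsArrs P s s′ →
               Env s → Env s′
    keepsEnv P t kv ka (em , en , eD , eμ , eE , ek , ei) =
      let t₁ = ∨-falseʳ {writesVar P vm} t
          t₂ = ∨-falseʳ {writesVar P vn} t₁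
          t₃ = ∨-falseʳ {writesVar P vD} t₂
          t₄ = ∨-falseʳ {writesVar P vμ} t₃
          t₅ = ∨-falseʳ {writesVar P vE} t₄
          t₆ = ∨-falseʳ {writesVar P vk} t₅ in
      trans (kv vm (∨-falseˡ t)) em , trans (kv vn (∨-falseˡ t₁)) en ,
      trans (kv vD (∨-falseˡ t₂)) eD , trans (kv vμ (∨-falseˡ t₃)) eμ ,
      trans (kv vE (∨-falseˡ t₄)) eE , trans (kv vk (∨-falseˡ t₅)) ek ,
      λ i → trans (cong-app (ka 0 t₆) i) (ei i)

    -- As in the other accumulator loops, the invariant combines the accumulator with the
    -- outstanding part and equates the result with the final value. This also bounds the memory:
    -- where the outstanding part is a factor of at least 1 or a non-negative summand, no
    -- intermediate value exceeds the final one.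
    run-power : ∀ {s b} → variables s ve ≡ b → b ≤ β ve → b ≤ N → 2 ^ b ≤ N →
                Run powerP s (λ s′ → variables s′ vpow ≡ 2 ^ b)
    run-power {s} {b} e≡b b≤β b≤N 2^b≤N =
      ev-lit 1≤N then
      run-map (run-loop I refl e≡b b≤β b≤N 1≤N (*-identityˡ (2 ^ b)) step)
        λ s′ _ _ inv → trans (sym (*-identityʳ _)) inv
      where
      I : ℕ → State → Set
      I j s′ = variables s′ vpow * 2 ^ j ≡ 2 ^ b
      step : ∀ j s′ → j < b → _ → _ → variables s′ ve ≡ suc j → I (suc j) s′ →
             Run (vpow := var vpow ⊕ var vpow) (set ve j s′) (I j)
      step j s′ _ _ _ _ inv = run-assign
        (ev-add (ev-var refl (≤-trans (m≤m+n v v) v+v≤N)) (ev-var refl (≤-trans (m≤m+n v v) v+v≤N)) v+v≤N)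
        double
        where
        v = variables s′ vpow
        lemma : ∀ v t → (v + v) * t ≡ v * (t + (t + 0))
        lemma = solve-∀
        double : (v + v) * 2 ^ j ≡ 2 ^ b
        double = trans (lemma v (2 ^ j)) inv
        v+v≤N : v + v ≤ N
        v+v≤N = ≤-trans (m≤m*n (v + v) (2 ^ j) {{m^n≢0 2 j}}) (≤-trans (≤-reflexive double) 2^b≤N)

    ev-half : ∀ {s} → variables s vT ≤ N → Ev halfE s (half (variables s vT))
    ev-half T≤N = ev-div (ev-var refl T≤N) (ev-lit 2≤N)

    ev-bit : ∀ {s} → variables s vT ≤ N → Ev bitE s (bit (variables s vT))
    ev-bit {s} T≤N = ev-sub (ev-var refl T≤N) (ev-mul (ev-lit 2≤N) (ev-half T≤N)
      (≤-trans (≤-reflexive (*-comm 2 (half (variables s vT)))) (≤-trans (m/n*n≤m (variables s vT) 2) T≤N)))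

    ev-dist : ∀ {s ec ex c x} → Env s → Ev ec s c → Ev ex s x → c < m → x < n →
              Ev (distE ec ex) s (dist c x)
    ev-dist {c = c} {x} (em , en , _ , _ , _ , _ , ei) pc px c<m x<n =
      ev-arr
        (ev-add (ev-lit 2≤N)
          (ev-add (ev-mul (ev-add (ev-var en n≤N) pc (≤-trans n+c≤n+m n+m≤N))
                          (ev-add (ev-var en n≤N) (ev-var em m≤N) n+m≤N)
                          (≤-trans row≤ (≤-trans (m≤n+m _ 2) (≤-trans (+-monoʳ-≤ 2 (m≤m+n _ _)) addr≤N))))
                  px (≤-trans (m≤n+m _ 2) in-range))
          in-range)
        (ei _) (≤-trans (dist≤D c<m x<n) D≤N)
      where
      n+c≤n+m : n + c ≤ n + m
      n+c≤n+m = +-monoʳ-≤ n (<⇒≤ c<m)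
      row≤ : (n + c) * (n + m) ≤ (n + m) * (n + m)
      row≤ = *-monoˡ-≤ (n + m) n+c≤n+m
      in-range : 2 + ((n + c) * (n + m) + x) ≤ N
      in-range = ≤-trans (+-monoʳ-≤ 2 (+-mono-≤ row≤ (≤-trans (<⇒≤ x<n) (m≤m+n n m)))) addr≤N

    run-clusters : ∀ {s c S} → Env s → variables s vcc ≡ c → c < m →
                   variables s vS ≡ S → S < 2 ^ n →
                   Run clustersP s (λ s′ → variables s′ vcl ≡ clusters c n S)
    run-clusters {s} {c} {S} env@(_ , en , _) cc≡c c<m S≡ S<2^n =
      ev-var S≡ S≤N then ev-lit 1≤N then ev-var en n≤N then
      run-map (run-loop I refl refl ≤-refl n≤N 1≤N (≤-refl , *-identityˡ _) step)
        λ s′ _ _ (_ , inv) → trans (sym (*-identityʳ _)) inv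
      where
      S≤N : S ≤ N
      S≤N = ≤-trans (<⇒≤ S<2^n) 2^n≤N
      s₀ = set vx n (set vcl 1 (set vT S s))
      I : ℕ → State → Set
      I j s′ = variables s′ vT ≤ S × variables s′ vcl * clusters c j (variables s′ vT) ≡ clusters c n S
      step : ∀ j s′ → j < n → KeepsVars (loop vx clusterStepP) s₀ s′ →
             KeepsArrs (loop vx clusterStepP) s₀ s′ → variables s′ vx ≡ suc j → I (suc j) s′ →
             Run clusterStepP (set vx j s′) (I j)
      step j s′ j<n kv ka _ (T≤S , inv)
        with keepsEnv (loop vx clusterStepP) refl kv ka env
      ... | env′@(_ , _ , eD , eμ , eE , _ , _) =
        ev-mul (ev-var eμ μ≤N)
               (ev-sub (ev-var eD D≤N)
                       (ev-dist env′ (ev-var (trans (kv vcc refl) cc≡c) (≤-trans (<⇒≤ c<m) m≤N))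
                                (ev-var refl (≤-trans (<⇒≤ j<n) n≤N)) c<m j<n))
               (≤-trans μd≤μD μD≤N) then
        run-seq (run-power refl (≤-trans μd≤μD (m≤m+n _ n)) (≤-trans μd≤μD μD≤N) (≤-trans (u≤E c j) E≤N))
          λ s″ kv″ _ pow≡ → finish s″ kv″ pow≡ (trans (kv″ vE refl) eE)
        where
        μd≤μD : μ * (D ∸ dist c j) ≤ μ * D
        μd≤μD = *-monoʳ-≤ μ (m∸n≤m D (dist c j))
        T P : ℕ
        T = variables s′ vT
        P = variables s′ vcl
        lemma : ∀ f p q → f * p * q ≡ p * (f * q)
        lemma = solve-∀
        finish : ∀ s″ → KeepsVars powerP (set ve (μ * (D ∸ dist c j)) (set vx j s′)) s″ →
                 variables s″ vpow ≡ u c j → variables s″ vE ≡ E →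
                 Run (vcl := (var vE ⊕ bitE ⊗ var vpow) ⊗ var vcl ⨾ vT := halfE) s″ (I j)
        finish s″ kv″ pow≡ eE″ =
          ev-≡ (cong (λ t → (E + bit t * u c j) * P) T≡)
            (ev-mul (ev-add (ev-var eE″ E≤N)
                       (ev-mul (ev-bit T″≤N) (ev-var pow≡ (≤-trans (u≤E c j) E≤N)) bu≤N)
                       (≤-trans (+-monoʳ-≤ E (bu≤u (variables s″ vT))) (≤-trans (E+u≤A c j) A≤N)))
                    (ev-var (kv″ vcl refl) P≤N)
                    (≤-trans (≤-reflexive (cong (λ t → (E + bit t * u c j) * P) T≡)) P′≤N)) then
          run-assign (ev-≡ (cong half T≡) (ev-half T″≤N))
            (≤-trans (m/n≤m T 2) T≤S , P′-inv)
          where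
          T≡ : variables s″ vT ≡ T
          T≡ = kv″ vT refl
          T≤N : T ≤ N
          T≤N = ≤-trans T≤S S≤N
          T″≤N : variables s″ vT ≤ N
          T″≤N = ≤-trans (≤-reflexive T≡) T≤N
          bu≤u : ∀ t → bit t * u c j ≤ u c j
          bu≤u t = ≤-trans (*-monoˡ-≤ (u c j) (bit≤1 t)) (≤-reflexive (*-identityˡ (u c j)))
          bu≤N : bit (variables s″ vT) * u c j ≤ N
          bu≤N = ≤-trans (bu≤u (variables s″ vT)) (≤-trans (u≤E c j) E≤N)
          P≤N : P ≤ N
          P≤N = ≤-trans (m≤m*n P _ {{>-nonZero (clusters≥1 E≥1 c (suc j) T)}})
                        (≤-trans (≤-reflexive inv) (clusters≤N c S))
          P′-inv : (E + bit T * u c j) * P * clusters c j (half T) ≡ clusters c n S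
          P′-inv = trans (lemma (E + bit T * u c j) P (clusters c j (half T))) inv
          P′≤N : (E + bit T * u c j) * P ≤ N
          P′≤N = ≤-trans (m≤m*n _ _ {{>-nonZero (clusters≥1 E≥1 c j (half T))}})
                         (≤-trans (≤-reflexive P′-inv) (clusters≤N c S))

    run-slot : ∀ {s f w S} → Env s → variables s vfirst ≡ f → variables s vcnt ≡ w → f + w ≤ m →
               variables s vS ≡ S → S < 2 ^ n →
               ∑< w (λ j → clusters (f + j) n S) ≤ N →
               Run slotP s (λ s′ → variables s′ vsum ≡ ∑< w (λ j → clusters (f + j) n S))
    run-slot {s} {f} {w} {S} env first≡ cnt≡ f+w≤m S≡ S<2^n sum≤N =
      ev-lit z≤n then
      run-map (run-loop I refl cnt≡ w≤m (≤-trans w≤m m≤N) 1≤N refl step)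
        λ s′ _ _ inv → trans (sym (+-identityʳ _)) inv
      where
      w≤m : w ≤ m
      w≤m = ≤-trans (m≤n+m w f) f+w≤m
      F : ℕ → ℕ
      F j = clusters (f + j) n S
      I : ℕ → State → Set
      I j s′ = variables s′ vsum + ∑< j F ≡ ∑< w F
      s₀ = set vsum 0 s
      step : ∀ j s′ → j < w → KeepsVars (loop vcnt slotStepP) s₀ s′ →
             KeepsArrs (loop vcnt slotStepP) s₀ s′ → variables s′ vcnt ≡ suc j → I (suc j) s′ →
             Run slotStepP (set vcnt j s′) (I j)
      step j s′ j<w kv ka _ inv =
        ev-add (ev-var (trans (kv vfirst refl) first≡) (≤-trans (≤-trans (m≤m+n f j) (<⇒≤ f+j<m)) m≤N))
               (ev-var refl (≤-trans (≤-trans (m≤n+m j f) (<⇒≤ f+j<m)) m≤N))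
               (≤-trans (<⇒≤ f+j<m) m≤N) then
        run-seq (run-clusters (keepsEnv (loop vcnt slotStepP) refl kv ka env) refl f+j<m
                              (trans (kv vS refl) S≡) S<2^n)
          λ s″ kv″ _ cl≡ →
            run-assign (ev-add (ev-var cl≡ (clusters≤N (f + j) S)) (ev-var (kv″ vsum refl) sum′≤N) new≤N)
              new-inv
        where
        f+j<m : f + j < m
        f+j<m = <-≤-trans (+-monoʳ-< f j<w) f+w≤m
        lemma : ∀ a b c → a + b + c ≡ b + (a + c)
        lemma = solve-∀
        new-inv : F j + variables s′ vsum + ∑< j F ≡ ∑< w F
        new-inv = trans (lemma (F j) _ _) inv
        new≤N : F j + variables s′ vsum ≤ N
        new≤N = ≤-trans (m≤m+n _ (∑< j F)) (≤-trans (≤-reflexive new-inv) sum≤N)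
        sum′≤N : variables s′ vsum ≤ N
        sum′≤N = ≤-trans (m≤n+m _ (F j)) new≤N

    Centers : ℕ → (ℕ → ℕ) → State → Set
    Centers i a s = ∀ l → i ≤ l → l < k → arrays s 1 (suc l) ≡ a l × a l < m

    keepsCenters : ∀ {i a s s′} → arrays s′ 1 ≡ arrays s 1 → Centers i a s → Centers i a s′
    keepsCenters eq h l i≤l l<k = trans (cong-app eq (suc l)) (proj₁ (h l i≤l l<k)) , proj₂ (h l i≤l l<k)

    ev-center : ∀ {s i a el l} → Centers i a s → i ≤ l → l < k → Ev el s l → Ev (centerE el) s (a l)
    ev-center {l = l} h i≤l l<k p =
      ev-arr (ev-add (ev-lit 1≤N) p (≤-trans l<k k≤N)) (proj₁ (h l i≤l l<k))
             (≤-trans (<⇒≤ (proj₂ (h l i≤l l<k))) m≤N)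

    run-slots : ∀ {s i a S} → Env s → variables s vi ≡ i → i ≤ k → Centers i a s →
                variables s vS ≡ S → S < 2 ^ n →
                Run slotsP s (λ s′ → variables s′ vprod ≡ slots i a S)
    run-slots {s} {i} {a} {S} env@(_ , _ , _ , _ , _ , ek , _) i≡ i≤k centers S≡ S<2^n =
      ev-lit 1≤N then ev-var ek k≤N then
      run-map (run-loop I refl refl k≤m k≤N 1≤N (*-identityˡ _) step)
        λ s′ _ _ inv → trans (sym (*-identityʳ _)) inv
      where
      F : ℕ → ℕ
      F l = slot i a l S
      ∏F≥1 : ∀ j → 1 ≤ ∏< j F
      ∏F≥1 j = ≤-trans (≤-reflexive (sym (trans (∏-const j 1) (^-zeroˡ j))))
                       (∏-mono j λ l _ → slot≥1 E≥1 1≤m i a l S)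
      I : ℕ → State → Set
      I j s′ = variables s′ vprod * ∏< j F ≡ ∏< k F
      s₀ = set vl k (set vprod 1 s)
      step : ∀ j s′ → j < k → KeepsVars (loop vl slotsStepP) s₀ s′ →
             KeepsArrs (loop vl slotsStepP) s₀ s′ → variables s′ vl ≡ suc j → I (suc j) s′ →
             Run slotsStepP (set vl j s′) (I j)
      step j s′ j<k kv ka _ inv
        with keepsEnv (loop vl slotsStepP) refl kv ka env
      ... | env′@(em′ , _) =
        run-seq {R = Selected} select λ s₁ kv₁ ka₁ (first≡ , cnt≡) →
        run-seq (run-slot (keepsEnv selectP refl kv₁ ka₁ env′) first≡ cnt≡ fits
                          (trans (kv₁ vS refl) (trans (kv vS refl) S≡)) S<2^n
                          (≤-trans (slot≤ E+u≤A 1≤m i a j S) slot≤N)) λ s₂ kv₂ _ sum≡ →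
        run-assign (ev-mul (ev-var sum≡ (≤-trans (slot≤ E+u≤A 1≤m i a j S) slot≤N))
                           (ev-var (trans (kv₂ vprod refl) (kv₁ vprod refl)) prod≤N)
                           new≤N)
          new-inv
        where
        Selected : State → Set
        Selected s₁ = variables s₁ vfirst ≡ first (i ∸ j) (a j) × variables s₁ vcnt ≡ width (i ∸ j) (a j)
        j≤N : j ≤ N
        j≤N = ≤-trans (<⇒≤ j<k) k≤N
        free : ∀ {d} c → d ≢ 0 → 0 ≡ first d c × m ≡ width d c
        free {zero}  c d≢0 = contradiction refl d≢0
        free {suc _} c d≢0 = refl , refl
        fixed : ∀ {d} c → d ≡ 0 → c ≡ first d c × 1 ≡ width d c
        fixed c refl = refl , refl
        select : Run selectP (set vl j s′) Selected
        select = run-if (ev-sub (ev-var (trans (kv vi refl) i≡) (≤-trans i≤k k≤N)) (ev-var refl j≤N))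
          (λ d≢0 → ev-lit z≤n then run-assign (ev-var em′ m≤N) (free (a j) d≢0))
          (λ d≡0 → ev-center (keepsCenters {s = s} {set vl j s′} (ka 1 refl) centers) (m∸n≡0⇒m≤n d≡0) j<k (ev-var refl j≤N)
                   then run-assign (ev-lit 1≤N) (fixed (a j) d≡0))
        fits′ : ∀ d → (d ≡ 0 → a j < m) → first d (a j) + width d (a j) ≤ m
        fits′ zero    h = ≤-trans (≤-reflexive (+-comm (a j) 1)) (h refl)
        fits′ (suc _) h = ≤-refl
        fits : first (i ∸ j) (a j) + width (i ∸ j) (a j) ≤ m
        fits = fits′ (i ∸ j) λ d≡0 → proj₂ (centers j (m∸n≡0⇒m≤n d≡0) j<k)
        lemma : ∀ f p q → f * p * q ≡ p * (f * q)
        lemma = solve-∀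
        new-inv : F j * variables s′ vprod * ∏< j F ≡ ∏< k F
        new-inv = trans (lemma (F j) _ _) inv
        new≤N : F j * variables s′ vprod ≤ N
        new≤N = ≤-trans (m≤m*n _ _ {{>-nonZero (∏F≥1 j)}})
                        (≤-trans (≤-reflexive new-inv) (slots≤N′ i a S))
        prod≤N : variables s′ vprod ≤ N
        prod≤N = ≤-trans (m≤n*m _ (F j) {{>-nonZero (slot≥1 E≥1 1≤m i a j S)}}) new≤N

    run-parity : ∀ {s S} → Env s → variables s vS ≡ S → S < 2 ^ n →
                 Run parityP s (λ s′ → variables s′ vpar ≡ parity n S 0)
    run-parity {s} {S} env@(_ , en , _) S≡ S<2^n =
      ev-var S≡ S≤N then ev-lit z≤n then ev-var en n≤N then
      run-map (run-loop I refl refl ≤-refl n≤N 1≤N (≤-refl , z≤n , refl) step)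
        λ s′ _ _ (_ , _ , inv) → inv
      where
      S≤N : S ≤ N
      S≤N = ≤-trans (<⇒≤ S<2^n) 2^n≤N
      s₀ = set vx n (set vpar 0 (set vT S s))
      I : ℕ → State → Set
      I j s′ = variables s′ vT ≤ S × variables s′ vpar ≤ 1 ×
               parity j (variables s′ vT) (variables s′ vpar) ≡ parity n S 0
      step : ∀ j s′ → j < n → KeepsVars (loop vx parityStepP) s₀ s′ →
             KeepsArrs (loop vx parityStepP) s₀ s′ → variables s′ vx ≡ suc j → I (suc j) s′ →
             Run parityStepP (set vx j s′) (I j)
      step j s′ j<n kv ka _ (T≤S , p≤1 , inv) =
        run-seq {R = λ s₁ → variables s₁ vT ≡ T × variables s₁ vpar ≡ flipUnless (bit T) p}
          (run-if (ev-bit {set vx j s′} T≤N)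
            (λ b≢0 → run-skip (refl , absent-no b≢0))
            (λ b≡0 → run-assign (ev-sub (ev-lit 1≤N) (ev-var refl (≤-trans p≤1 1≤N)))
                                (refl , absent-yes b≡0)))
          λ s₁ _ _ (T≡ , p≡) →
            run-assign (ev-≡ (cong half T≡) (ev-half (≤-trans (≤-reflexive T≡) T≤N)))
              (≤-trans (m/n≤m T 2) T≤S , ≤-trans (≤-reflexive p≡) (flip≤1 (bit T)) ,
               trans (cong (parity j (half T)) p≡) inv)
        where
        T p : ℕ
        T = variables s′ vT
        p = variables s′ vpar
        T≤N : T ≤ N
        T≤N = ≤-trans T≤S S≤N
        absent-no : ∀ {b} → b ≢ 0 → p ≡ flipUnless b p
        absent-no {zero}  b≢0 = contradiction refl b≢0
        absent-no {suc _} b≢0 = refl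
        absent-yes : ∀ {b} → b ≡ 0 → 1 ∸ p ≡ flipUnless b p
        absent-yes refl = refl
        flip≤1 : ∀ b → flipUnless b p ≤ 1
        flip≤1 zero    = m∸n≤m 1 p
        flip≤1 (suc _) = p≤1

    run-total : ∀ {s i a} → Env s → variables s vi ≡ i → i ≤ k → Centers i a s →
                Run totalP s (λ s′ → variables s′ vpos ≡ ∑± n 0 (slots i a) ×
                                     variables s′ vneg ≡ ∑± n 1 (slots i a))
    run-total {s} {i} {a} env@(_ , en , _) i≡ i≤k centers =
      ev-lit z≤n then ev-lit z≤n then ev-var en n≤N then
      run-seq (run-power refl (m≤n+m n (μ * D)) n≤N 2^n≤N) λ s₁ kv₁ ka₁ pow≡ →
      ev-var pow≡ 2^n≤N then
      run-map (run-loop I refl refl ≤-refl 2^n≤N 1≤N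
                (cong (_+ ∑± n 0 F) (kv₁ vpos refl) , cong (_+ ∑± n 1 F) (kv₁ vneg refl))
                (step s₁ kv₁ ka₁))
        λ s′ _ _ (p , q) → trans (sym (+-identityʳ _)) p , trans (sym (+-identityʳ _)) q
      where
      F G₀ G₁ : ℕ → ℕ
      F S  = slots i a S
      G₀ S = ifZero (parity n S 0) (F S)
      G₁ S = ifZero (parity n S 1) (F S)
      s₀ = set ve n (set vneg 0 (set vpos 0 s))
      I : ℕ → State → Set
      I j s′ = variables s′ vpos + ∑< j G₀ ≡ ∑± n 0 F × variables s′ vneg + ∑< j G₁ ≡ ∑± n 1 F
      step : ∀ s₁ → KeepsVars powerP s₀ s₁ → KeepsArrs powerP s₀ s₁ →
             ∀ j s′ → j < 2 ^ n → KeepsVars (loop vS totalStepP) (set vS (2 ^ n) s₁) s′ →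
             KeepsArrs (loop vS totalStepP) (set vS (2 ^ n) s₁) s′ → variables s′ vS ≡ suc j →
             I (suc j) s′ → Run totalStepP (set vS j s′) (I j)
      step s₁ kv₁ ka₁ j s′ j<2^n kv ka _ (pos-inv , neg-inv) =
        run-seq (run-parity env′ refl j<2^n) λ s₂ kv₂ ka₂ par≡ →
        run-seq (run-slots {i = i} {a} (keepsEnv parityP refl kv₂ ka₂ env′)
                           (trans (kv₂ vi refl) (trans (kv vi refl) (trans (kv₁ vi refl) i≡))) i≤k
                           (keepsCenters {s = s} {s₂} (trans (ka₂ 1 refl) (trans (ka 1 refl) (ka₁ 1 refl))) centers)
                           (kv₂ vS refl) j<2^n) λ s₃ kv₃ _ prod≡ →
        let pos≡ = trans (kv₃ vpos refl) (kv₂ vpos refl)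
            neg≡ = trans (kv₃ vneg refl) (kv₂ vneg refl) in
        -- In either branch the mask enters one of the sums `G₀` and `G₁` and contributes 0 to the
        -- other, so both invariants advance.
        run-if (ev-var (trans (kv₃ vpar refl) par≡) (≤-trans (parity≤1 n j z≤n) 1≤N))
          (λ odd → let g = odd-case odd in
            run-assign (ev-add (ev-var prod≡ (slots≤N′ i a j)) (ev-var neg≡ neg≤N)
                               (≤-trans (≤-reflexive (cong (_+ neg) (sym (proj₂ g)))) neg′≤N))
              (trans (cong (_+ ∑< j G₀) (trans pos≡ (cong (_+ pos) (sym (proj₁ g))))) pos′ ,
               trans (cong (λ z → z + neg + ∑< j G₁) (sym (proj₂ g))) neg′))
          (λ even → let g = even-case even in
            run-assign (ev-add (ev-var prod≡ (slots≤N′ i a j)) (ev-var pos≡ pos≤N)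
                               (≤-trans (≤-reflexive (cong (_+ pos) (sym (proj₁ g)))) pos′≤N))
              (trans (cong (λ z → z + pos + ∑< j G₀) (sym (proj₁ g))) pos′ ,
               trans (cong (_+ ∑< j G₁) (trans neg≡ (cong (_+ neg) (sym (proj₂ g))))) neg′))
        where
        env′ = keepsEnv (loop vS totalStepP) {set vS (2 ^ n) s₁} {s′} refl kv ka (keepsEnv powerP {s₀} {s₁} refl kv₁ ka₁ env)
        pos neg : ℕ
        pos = variables s′ vpos
        neg = variables s′ vneg
        lemma : ∀ g p q → g + p + q ≡ p + (g + q)
        lemma = solve-∀
        pos′ : G₀ j + pos + ∑< j G₀ ≡ ∑± n 0 F
        pos′ = trans (lemma (G₀ j) pos _) pos-inv
        neg′ : G₁ j + neg + ∑< j G₁ ≡ ∑± n 1 F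
        neg′ = trans (lemma (G₁ j) neg _) neg-inv
        pos′≤N : G₀ j + pos ≤ N
        pos′≤N = ≤-trans (m≤m+n _ _) (≤-trans (≤-reflexive pos′) (∑±≤N i a 0))
        neg′≤N : G₁ j + neg ≤ N
        neg′≤N = ≤-trans (m≤m+n _ _) (≤-trans (≤-reflexive neg′) (∑±≤N i a 1))
        pos≤N : pos ≤ N
        pos≤N = ≤-trans (m≤n+m pos (G₀ j)) pos′≤N
        neg≤N : neg ≤ N
        neg≤N = ≤-trans (m≤n+m neg (G₁ j)) neg′≤N
        G₁≡ : G₁ j ≡ ifZero (1 ∸ parity n j 0) (F j)
        G₁≡ = cong (λ b → ifZero b (F j)) (parity-flip n j z≤n)
        odd-case : parity n j 0 ≢ 0 → G₀ j ≡ 0 × G₁ j ≡ F j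
        odd-case p≢0 = go (parity n j 0) (parity≤1 n j z≤n) p≢0 G₁≡
          where
          go : ∀ b → b ≤ 1 → b ≢ 0 → G₁ j ≡ ifZero (1 ∸ b) (F j) → ifZero b (F j) ≡ 0 × G₁ j ≡ F j
          go zero          _        b≢0 _  = contradiction refl b≢0
          go (suc zero)    _        _   eq = refl , eq
          go (suc (suc _)) (s≤s ())
        even-case : parity n j 0 ≡ 0 → G₀ j ≡ F j × G₁ j ≡ 0
        even-case p≡0 = cong (λ b → ifZero b (F j)) p≡0 , trans G₁≡ (cong (λ b → ifZero (1 ∸ b) (F j)) p≡0)

    run-choose : ∀ {s i a} → Env s → variables s vi ≡ i → i < k → Centers (suc i) a s →
                 Run chooseP s (λ s′ → ∃[ a′ ] (Centers i a′ s′ × total (suc i) a ≤ m * total i a′))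
    run-choose {s} {i} {a} env@(em , _) i≡ i<k centers =
      ev-lit z≤n then ev-lit z≤n then ev-var em m≤N then
      run-seq (run-loop I refl refl ≤-refl m≤N 1≤N
                -- Center 0, present because m is positive, starts as the best one; its recorded
                -- value 0 only has to be a lower bound of its score.
                (centers , 1≤m , z≤n , λ c m≤c c<m → contradiction c<m (≤⇒≯ m≤c)) step)
        λ s′ kv _ (cs , b<m , best≤ , ≤best) →
          run-store (ev-add (ev-lit 1≤N) (ev-var (trans (kv vi refl) i≡) i≤N) 1+i≤N)
                    (ev-var refl (≤-trans (<⇒≤ b<m) m≤N))
            (a [ i ↦ variables s′ vbestc ] , fix {s′} cs b<m ,
             -- The total is a sum of m scores, each at most the best: this is the factor m lost in
             -- this slot.
             ≤-trans (∑-mono m λ c c<m → ≤-trans (≤best c z≤n c<m) best≤)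
                     (≤-reflexive (∑-const m _)))
      where
      1+i≤N : suc i ≤ N
      1+i≤N = ≤-trans i<k k≤N
      i≤N : i ≤ N
      i≤N = <⇒≤ 1+i≤N
      fix : ∀ {s₁ c} → Centers (suc i) a s₁ → c < m →
            Centers i (a [ i ↦ c ]) (store 1 (suc i) c s₁)
      fix {s₁} {c} cs c<m l i≤l l<k with m≤n⇒m<n∨m≡n i≤l
      ... | inj₁ i<l =
        trans (↦-other (λ l → arrays s₁ 1 (suc l)) c (<⇒≢ i<l))
              (trans (proj₁ (cs l i<l l<k)) (sym (↦-other a c (<⇒≢ i<l)))) ,
        ≤-trans (s≤s (≤-reflexive (↦-other a c (<⇒≢ i<l)))) (proj₂ (cs l i<l l<k))
      ... | inj₂ refl =
        trans (↦-same (λ l → arrays s₁ 1 (suc l)) i c) (sym (↦-same a i c)) ,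
        ≤-trans (s≤s (≤-reflexive (↦-same a i c))) c<m
      score : ℕ → ℕ
      score c = total i (a [ i ↦ c ])
      score-∑± : ∀ c → ∑± n 0 (slots i (a [ i ↦ c ])) ≡ ∑± n 1 (slots i (a [ i ↦ c ])) + score c
      score-∑± c = slots-alternating i (a [ i ↦ c ]) (<⇒≤ i<k)
      score≤N : ∀ c → score c ≤ N
      score≤N c = ≤-trans (m≤n+m (score c) _) (≤-trans (≤-reflexive (sym (score-∑± c))) (∑±≤N i _ 0))
      I : ℕ → State → Set
      I j s′ = Centers (suc i) a s′ × variables s′ vbestc < m ×
               variables s′ vbest ≤ score (variables s′ vbestc) ×
               (∀ c → j ≤ c → c < m → score c ≤ variables s′ vbest)
      s₀ = set vc m (set vbestc 0 (set vbest 0 s))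
      step : ∀ j s′ → j < m → KeepsVars (loop vc trialP) s₀ s′ →
             KeepsArrs (loop vc trialP) s₀ s′ → variables s′ vc ≡ suc j → I (suc j) s′ →
             Run trialP (set vc j s′) (I j)
      step j s′ j<m kv ka _ (cs , b<m , best≤ , ≤best) =
        run-seq {R = _≡ s₁}
          (run-store (ev-add (ev-lit 1≤N) (ev-var i≡′ i≤N) 1+i≤N) (ev-var refl (≤-trans (<⇒≤ j<m) m≤N)) refl)
          λ { _ _ _ refl →
        run-seq (run-total {s₁} {i} {a [ i ↦ j ]} env′ i≡′ (<⇒≤ i<k) (fix {set vc j s′} cs j<m))
          λ s₂ kv₂ ka₂ (pos≡ , neg≡) →
        let best≡  = kv₂ vbest refl
            bestc≡ = kv₂ vbestc refl
            ev-score : ∀ {s₃} → variables s₃ vpos ≡ variables s₂ vpos → variables s₃ vneg ≡ variables s₂ vneg →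
                       Ev (var vpos ⊖ var vneg) s₃ (score j)
            -- Truncated subtraction is exact here, since the positive sum equals the negative one
            -- plus the score.
            ev-score p q = ev-≡ (trans (cong (_∸ neg j) (score-∑± j)) (m+n∸m≡n (neg j) (score j)))
              (ev-sub (ev-var (trans p pos≡) (∑±≤N i _ 0)) (ev-var (trans q neg≡) (∑±≤N i _ 1)))
            cs₂ : Centers (suc i) a s₂
            cs₂ = λ l i<l l<k →
              trans (cong-app (ka₂ 1 refl) (suc l))
                (trans (↦-other (λ l → arrays s′ 1 (suc l)) j (<⇒≢ i<l)) (proj₁ (cs l i<l l<k))) ,
              proj₂ (cs l i<l l<k)
        in
        run-if (ev-sub (ev-score refl refl) (ev-var best≡ (≤-trans best≤ (score≤N (variables s′ vbestc)))))
          (λ d≢0 → ev-score refl refl then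
            run-assign (ev-var (kv₂ vc refl) (≤-trans (<⇒≤ j<m) m≤N))
              (cs₂ , j<m , ≤-refl , improved (<⇒≤ (m∸n≢0⇒n<m d≢0)) ≤-refl))
          (λ d≡0 → run-skip (cs₂ , subst (_< m) (sym bestc≡) b<m ,
            subst₂ (λ b c → b ≤ score c) (sym best≡) (sym bestc≡) best≤ ,
            subst (λ b → ∀ c → j ≤ c → c < m → score c ≤ b) (sym best≡) (improved ≤-refl (m∸n≡0⇒m≤n d≡0)))) }
        where
        s₁ = store 1 (suc i) j (set vc j s′)
        i≡′ : variables s′ vi ≡ i
        i≡′ = trans (kv vi refl) i≡
        env′ : Env s₁
        env′ = keepsEnv (loop vc trialP) {s₀} {s′} refl kv ka env
        neg : ℕ → ℕ
        neg c = ∑± n 1 (slots i (a [ i ↦ c ]))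
        improved : ∀ {b} → variables s′ vbest ≤ b → score j ≤ b → ∀ c → j ≤ c → c < m → score c ≤ b
        improved old≤b new≤b c j≤c c<m with m≤n⇒m<n∨m≡n j≤c
        ... | inj₁ j<c  = ≤-trans (≤best c j<c c<m) old≤b
        ... | inj₂ refl = new≤b

    run-centers : ∀ {s} → Env s →
                  Run centersP s (λ s′ → ∃[ a ] (Centers 0 a s′ × total k (λ _ → 0) ≤ m ^ k * total 0 a))
    run-centers {s} env@(_ , _ , _ , _ , _ , ek , _) =
      ev-var ek k≤N then
      run-map (run-loop I refl refl k≤m k≤N 1≤N
                ((λ _ → 0) , (λ l k≤l l<k → contradiction l<k (≤⇒≯ k≤l)) , ≤-reflexive (*-comm _ (m ^ k))) step)
        λ s′ _ _ (a , cs , good) → a , cs , ≤-trans (≤-reflexive (sym (*-identityʳ _))) good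
      where
      all-free = total k (λ _ → 0)
      I : ℕ → State → Set
      -- The loss so far is m^(k - j); the factor `m ^ j` on the left replaces the subtraction in
      -- the exponent.
      I j s′ = ∃[ a ] (Centers j a s′ × all-free * m ^ j ≤ m ^ k * total j a)
      s₀ = set vi k s
      step : ∀ j s′ → j < k → KeepsVars (loop vi chooseP) s₀ s′ →
             KeepsArrs (loop vi chooseP) s₀ s′ → variables s′ vi ≡ suc j → I (suc j) s′ →
             Run chooseP (set vi j s′) (I j)
      step j s′ j<k kv ka _ (a , cs , good) =
        run-map (run-choose {set vi j s′} {j} {a} (keepsEnv (loop vi chooseP) {s₀} {s′} refl kv ka env) refl j<k cs)
          λ s″ _ _ (a′ , cs′ , better) → a′ , cs′ , *-cancelˡ-≤ m {{>-nonZero 1≤m}} (begin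
            m * (all-free * m ^ j)        ≡⟨ lemma m all-free (m ^ j) ⟩
            all-free * m ^ suc j          ≤⟨ good ⟩
            m ^ k * total (suc j) a    ≤⟨ *-monoʳ-≤ (m ^ k) better ⟩
            m ^ k * (m * total j a′)   ≡⟨ lemma (m ^ k) m (total j a′) ⟩
            m * (m ^ k * total j a′)   ∎)
        where
        open ≤-Reasoning
        lemma : ∀ a b c → a * (b * c) ≡ b * (a * c)
        lemma = solve-∀

    Nearest : ℕ → (ℕ → ℕ) → State → Set
    Nearest i a s = ∀ x → i ≤ x → x < n →
      arrays s 1 (suc (k + x)) < k ×
      (∀ l → l < k → dist (a (arrays s 1 (suc (k + x)))) x ≤ dist (a l) x)

    run-nearest : ∀ {s a x} → Env s → variables s vx ≡ x → x < n → Centers 0 a s →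
                  Run nearestP s (λ s′ → ∃[ g ] (arrays s′ 1 ≡ arrays s 1 [ suc (k + x) ↦ g ] ×
                    g < k × (∀ l → l < k → dist (a g) x ≤ dist (a l) x)))
    run-nearest {s} {a} {x} env@(_ , _ , _ , _ , _ , ek , _) x≡ x<n centers =
      ev-lit z≤n then ev-var ek k≤N then
      run-seq (run-loop I refl refl k≤m k≤N 1≤N
                -- The search starts from slot 0, which exists because k is positive.
                (1≤k , λ l k≤l l<k → contradiction l<k (≤⇒≯ k≤l)) step)
        λ s′ kv ka (g<k , near) →
          run-store
            (ev-add (ev-lit 1≤N)
              (ev-add (ev-var (trans (kv vk refl) ek) k≤N) (ev-var (trans (kv vx refl) x≡) (≤-trans (<⇒≤ x<n) n≤N))
                      (<⇒≤ 1+k+x≤N)) 1+k+x≤N)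
            (ev-var refl (≤-trans (<⇒≤ g<k) k≤N))
            (variables s′ vnear , cong (_[ suc (k + x) ↦ variables s′ vnear ]) (ka 1 refl) ,
             g<k , λ l → near l z≤n)
      where
      1+k+x≤N : suc (k + x) ≤ N
      1+k+x≤N = ≤-trans (s≤s (≤-trans (+-mono-≤ k≤m (<⇒≤ x<n)) (≤-reflexive (+-comm m n))))
                        (<⇒≤ 2+n+m≤N)
      I : ℕ → State → Set
      I j s′ = variables s′ vnear < k ×
               (∀ l → j ≤ l → l < k → dist (a (variables s′ vnear)) x ≤ dist (a l) x)
      s₀ = set vl k (set vnear 0 s)
      step : ∀ j s′ → j < k → KeepsVars (loop vl compareP) s₀ s′ →
             KeepsArrs (loop vl compareP) s₀ s′ → variables s′ vl ≡ suc j → I (suc j) s′ →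
             Run compareP (set vl j s′) (I j)
      step j s′ j<k kv ka _ (g<k , near) =
        run-if (ev-sub (ev-slot g<k (ev-var refl (≤-trans (<⇒≤ g<k) k≤N))) (ev-slot j<k ev-j))
          (λ d≢0 → run-assign ev-j (j<k , nearer (<⇒≤ (m∸n≢0⇒n<m d≢0)) ≤-refl))
          (λ d≡0 → run-skip (g<k , nearer ≤-refl (m∸n≡0⇒m≤n d≡0)))
        where
        ev-j : Ev (var vl) (set vl j s′) j
        ev-j = ev-var refl (≤-trans (<⇒≤ j<k) k≤N)
        cs : Centers 0 a (set vl j s′)
        cs = keepsCenters {s = s} {set vl j s′} (ka 1 refl) centers
        ev-slot : ∀ {e l} → l < k → Ev e (set vl j s′) l →
                  Ev (distE (centerE e) (var vx)) (set vl j s′) (dist (a l) x)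
        ev-slot l<k p = ev-dist (keepsEnv (loop vl compareP) {s₀} {s′} refl kv ka env)
          (ev-center cs z≤n l<k p) (ev-var (trans (kv vx refl) x≡) (≤-trans (<⇒≤ x<n) n≤N))
          (proj₂ (cs _ z≤n l<k)) x<n
        nearer : ∀ {d} → d ≤ dist (a (variables s′ vnear)) x → d ≤ dist (a j) x →
                 ∀ l → j ≤ l → l < k → d ≤ dist (a l) x
        nearer d≤old d≤new l j≤l l<k with m≤n⇒m<n∨m≡n j≤l
        ... | inj₁ j<l  = ≤-trans d≤old (near l j<l l<k)
        ... | inj₂ refl = d≤new

    run-assign-all : ∀ {s a} → Env s → Centers 0 a s →
                     Run assignP s (λ s′ → Centers 0 a s′ × Nearest 0 a s′)
    run-assign-all {s} {a} env@(_ , en , _) centers =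
      ev-var en n≤N then
      run-loop I refl refl ≤-refl n≤N 1≤N
        (centers , λ x n≤x x<n → contradiction x<n (≤⇒≯ n≤x)) step
      where
      I : ℕ → State → Set
      I j s′ = Centers 0 a s′ × Nearest j a s′
      s₀ = set vx n s
      step : ∀ j s′ → j < n → KeepsVars (loop vx nearestP) s₀ s′ →
             KeepsArrs (loop vx nearestP) s₀ s′ → variables s′ vx ≡ suc j → I (suc j) s′ →
             Run nearestP (set vx j s′) (I j)
      step j s′ j<n kv ka _ (cs , near) =
        run-map (run-nearest {set vx j s′} {a} (keepsEnv (loop vx nearestP) {s₀} {s′} refl kv ka env) refl j<n cs)
          λ s″ _ _ (g , arr≡ , g<k , g-near) →
            (λ l _ l<k →
              trans (cong-app arr≡ (suc l))
                -- The centers occupy cells 1 to k and the assignments begin at cell k + 1, so the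
                -- store cannot hit a center.
                (trans (↦-other (arrays s′ 1) g (λ eq → contradiction l<k
                          (≤⇒≯ (≤-trans (m≤m+n k j) (≤-reflexive (suc-injective eq))))))
                       (proj₁ (cs l z≤n l<k))) ,
              proj₂ (cs l z≤n l<k)) ,
            λ x j≤x x<n → by-cases s″ g arr≡ g<k g-near x x<n (m≤n⇒m<n∨m≡n j≤x)
        where
        by-cases : ∀ s″ g → arrays s″ 1 ≡ arrays s′ 1 [ suc (k + j) ↦ g ] → g < k →
                   (∀ l → l < k → dist (a g) j ≤ dist (a l) j) → ∀ x → x < n → j < x ⊎ j ≡ x →
                   arrays s″ 1 (suc (k + x)) < k ×
                   (∀ l → l < k → dist (a (arrays s″ 1 (suc (k + x)))) x ≤ dist (a l) x)
        by-cases s″ g arr≡ g<k g-near x x<n (inj₁ j<x) =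
          subst (λ g → g < k × (∀ l → l < k → dist (a g) x ≤ dist (a l) x))
            (sym (trans (cong-app arr≡ (suc (k + x)))
              (↦-other (arrays s′ 1) g (λ eq → <⇒≢ j<x (+-cancelˡ-≡ k j x (suc-injective eq))))))
            (near x j<x x<n)
        by-cases s″ g arr≡ g<k g-near x x<n (inj₂ refl) =
          subst (λ g → g < k × (∀ l → l < k → dist (a g) x ≤ dist (a l) x))
            (sym (trans (cong-app arr≡ (suc (k + j))) (↦-same (arrays s′ 1) (suc (k + j)) g)))
            (g<k , g-near)

    run-solve : ∀ {s} → Env s →
                Run solveP s (λ s′ → ∃[ a ] (total k (λ _ → 0) ≤ m ^ k * total 0 a ×
                                             arrays s′ 1 0 ≡ k × Centers 0 a s′ × Nearest 0 a s′))
    run-solve {s} env =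
      run-seq (run-centers env) λ s₁ kv₁ ka₁ (a , cs₁ , good) →
      run-seq (run-assign-all {s₁} {a} (env′ s₁ kv₁ ka₁) cs₁) λ s₂ kv₂ ka₂ (cs₂ , near) →
      run-store (ev-lit z≤n) (ev-var (trans (kv₂ vk refl) (k≡ s₁ (env′ s₁ kv₁ ka₁))) k≤N)
        (a , good , refl , cs₂ , near)
      where
      env′ : ∀ s₁ → KeepsVars centersP s s₁ → KeepsArrs centersP s s₁ → Env s₁
      env′ s₁ kv ka = keepsEnv centersP {s} {s₁} refl kv ka env
      k≡ : ∀ s₁ → Env s₁ → variables s₁ vk ≡ k
      k≡ _ (_ , _ , _ , _ , _ , ek , _) = ek

    ev-poly : ∀ p {s} → variables s vm ≡ m → variables s vn ≡ n → ⟦ majorant p ⟧ m n ≤ N →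
              Ev (compile p) s (⟦ p ⟧ m n)
    ev-poly (con c)  em en h = ev-lit h
    ev-poly 𝑚        em en h = ev-var em h
    ev-poly 𝑛        em en h = ev-var en h
    ev-poly (p :+ q) em en h = ev-add
      (ev-poly p em en (≤-trans (m≤m+n _ _) (≤-trans (m≤m+n _ (⟦ p :+ q ⟧ m n)) h)))
      (ev-poly q em en (≤-trans (m≤n+m _ (⟦ majorant p ⟧ m n)) (≤-trans (m≤m+n _ (⟦ p :+ q ⟧ m n)) h)))
      (≤-trans (m≤n+m _ (⟦ majorant p ⟧ m n + ⟦ majorant q ⟧ m n)) h)
    ev-poly (p :* q) em en h = ev-mul
      (ev-poly p em en (≤-trans (m≤m+n _ _) (≤-trans (m≤m+n _ (⟦ p :* q ⟧ m n)) h)))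
      (ev-poly q em en (≤-trans (m≤n+m _ (⟦ majorant p ⟧ m n)) (≤-trans (m≤m+n _ (⟦ p :* q ⟧ m n)) h)))
      (≤-trans (m≤n+m _ (⟦ majorant p ⟧ m n + ⟦ majorant q ⟧ m n)) h)

    module _
      (digit       : ℕ → ℕ)
      (inp-m       : inp 0 ≡ m)
      (inp-n       : inp 1 ≡ n)
      (inp-digits  : ∀ i → inp (2 + ((n + m) * (n + m) + i)) ≡ digit i)
      (digit≤2     : ∀ i → digit i ≤ 2)
      (k-digits    : ∑< m (λ i → 2 ^ i * digit i) ⊓ m ≡ k)
      (2*2^m≤N     : 2 * 2 ^ m ≤ N)
      where

      run-read : ∀ {s} → variables s vm ≡ m → variables s vn ≡ n → (∀ i → arrays s 0 i ≡ inp i) →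
                 Run readP s (λ s′ → variables s′ vk ≡ k)
      run-read {s} em en ei =
        ev-lit z≤n then ev-var em m≤N then
        run-seq (run-loop I refl refl ≤-refl m≤N 1≤N refl step)
          λ s′ kv _ inv →
            let h≡ = trans (sym (trans (+-identityʳ _) (*-identityʳ _))) inv
                h-ev = ev-var h≡ h≤N in
            run-assign (ev-sub h-ev (ev-sub h-ev (ev-var (trans (kv vm refl) em) m≤N)))
              (trans (h∸[h∸m] m) k-digits)
        where
        F : ℕ → ℕ
        F i = 2 ^ i * digit i
        h : ℕ
        h = ∑< m F
        -- Bijective digits go up to 2, so j of them reach at most 2 * 2^j - 2. Without the slack of
        -- 2 the bound would have to be stated by subtraction.
        ∑F≤ : ∀ j → ∑< j F + 2 ≤ 2 * 2 ^ j
        ∑F≤ zero    = ≤-refl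
        ∑F≤ (suc j) = begin
          2 ^ j * digit j + ∑< j F + 2     ≡⟨ +-assoc (2 ^ j * digit j) (∑< j F) 2 ⟩
          2 ^ j * digit j + (∑< j F + 2)   ≤⟨ +-mono-≤ (*-monoʳ-≤ (2 ^ j) (digit≤2 j)) (∑F≤ j) ⟩
          2 ^ j * 2 + 2 * 2 ^ j            ≡⟨ lemma (2 ^ j) ⟩
          2 * 2 ^ suc j                    ∎
          where
          open ≤-Reasoning
          lemma : ∀ t → t * 2 + 2 * t ≡ 2 * (2 * t)
          lemma = solve-∀
        h∸[h∸m] : ∀ m → h ∸ (h ∸ m) ≡ h ⊓ m
        h∸[h∸m] m = trans (cong (_∸ (h ∸ m)) (sym (m⊓n+n∸m≡n m h)))
                          (trans (m+n∸n≡m (m ⊓ h) (h ∸ m)) (⊓-comm m h))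
        h≤N : h ≤ N
        h≤N = ≤-trans (m≤m+n h 2) (≤-trans (∑F≤ m) 2*2^m≤N)
        I : ℕ → State → Set
        I j s′ = variables s′ vk * 2 ^ j + ∑< j F ≡ h
        s₀ = set vl m (set vk 0 s)
        step : ∀ j s′ → j < m → KeepsVars (loop vl digitStepP) s₀ s′ →
               KeepsArrs (loop vl digitStepP) s₀ s′ → variables s′ vl ≡ suc j → I (suc j) s′ →
               Run digitStepP (set vl j s′) (I j)
        step j s′ j<m kv ka _ inv =
          run-assign
            (ev-add (ev-mul (ev-lit 2≤N) (ev-var refl (≤-trans (m≤n*m v 2) 2v≤N)) 2v≤N)
              (ev-arr
                (ev-add (ev-lit 2≤N)
                  (ev-add (ev-mul ev-n+m ev-n+m (≤-trans (m≤m+n _ j) (≤-trans (m≤n+m _ 2) in-range)))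
                          (ev-var refl (≤-trans (<⇒≤ j<m) m≤N)) (≤-trans (m≤n+m _ 2) in-range))
                  in-range)
                (trans (cong-app (ka 0 refl) _) (trans (ei _) (inp-digits j)))
                (≤-trans (digit≤2 j) 2≤N))
              new≤N)
            new-inv
          where
          v : ℕ
          v = variables s′ vk
          ev-n+m : Ev (var vn ⊕ var vm) (set vl j s′) (n + m)
          ev-n+m = ev-add (ev-var (trans (kv vn refl) en) n≤N) (ev-var (trans (kv vm refl) em) m≤N) n+m≤N
          in-range : 2 + ((n + m) * (n + m) + j) ≤ N
          in-range = ≤-trans (+-monoʳ-≤ 2 (+-monoʳ-≤ ((n + m) * (n + m)) (≤-trans (<⇒≤ j<m) (m≤n+m m n)))) addr≤N
          lemma : ∀ v e t r → (2 * v + e) * t + r ≡ v * (2 * t) + (t * e + r)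
          lemma = solve-∀
          new-inv : (2 * v + digit j) * 2 ^ j + ∑< j F ≡ h
          new-inv = trans (lemma v (digit j) (2 ^ j) _) inv
          new≤N : 2 * v + digit j ≤ N
          new≤N = ≤-trans (m≤m*n _ (2 ^ j) {{m^n≢0 2 j}})
                          (≤-trans (m≤m+n _ (∑< j F)) (≤-trans (≤-reflexive new-inv) h≤N))
          2v≤N : 2 * v ≤ N
          2v≤N = ≤-trans (m≤m+n _ (digit j)) new≤N

      run-program : ∀ p {s} → ⟦ p ⟧ m n ≡ D → ⟦ majorant p ⟧ m n ≤ N → (∀ i → arrays s 0 i ≡ inp i) →
                    Run (program p) s
                      (λ s′ → ∃[ a ] (total k (λ _ → 0) ≤ m ^ k * total 0 a ×
                                      arrays s′ 1 0 ≡ k × Centers 0 a s′ × Nearest 0 a s′))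
      run-program p {s} p≡D majorant≤N ei = run-seq init λ _ _ _ env → run-solve env
        where
        init : Run (initP p) s Env
        init =
          ev-arr (ev-lit z≤n) (trans (ei 0) inp-m) m≤N then
          ev-arr (ev-lit 1≤N) (trans (ei 1) inp-n) n≤N then
          ev-≡ p≡D (ev-poly p refl refl majorant≤N) then
          ev-add (ev-lit 1≤N)
            (ev-add (ev-mul (ev-var refl m≤N) (ev-var refl n≤N) (≤-trans (m≤m+n _ _) mn+mm≤N))
                    (ev-mul (ev-var refl m≤N) (ev-var refl m≤N) (≤-trans (m≤n+m _ (m * n)) mn+mm≤N))
                    mn+mm≤N)
            μ≤N then
          ev-mul (ev-var refl μ≤N) (ev-var refl D≤N) μD≤N then
          run-seq (run-power refl (m≤m+n _ n) μD≤N E≤N) λ s₁ kv₁ ka₁ pow≡ →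
          ev-var pow≡ E≤N then
          run-map (run-read {set vE E s₁} (kv₁ vm refl) (kv₁ vn refl)
                            (λ i → trans (cong-app (ka₁ 0 refl) i) (ei i)))
            λ s₂ kv₂ ka₂ k≡ →
              trans (kv₂ vm refl) (kv₁ vm refl) , trans (kv₂ vn refl) (kv₁ vn refl) ,
              trans (kv₂ vD refl) (kv₁ vD refl) , trans (kv₂ vμ refl) (kv₁ vμ refl) ,
              kv₂ vE refl , k≡ ,
              λ i → trans (cong-app (ka₂ 0 refl) i) (trans (cong-app (ka₁ 0 refl) i) (ei i))
          where
          mn+mm≤N : m * n + m * m ≤ N
          mn+mm≤N = ≤-trans (n≤1+n _) μ≤N

-- Step counts as a power of 2^n times a polynomial

boundPoly : (ℕ → Poly) → Expr → Poly
boundPoly π (var x) = π x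
boundPoly π _       = con 0

countPoly : (ℕ → Poly) → Program → Poly
countPoly π skip               = con 1
countPoly π (x := e)           = con (weight e + 2)
countPoly π (a [ e₁ ]:= e₂)    = con (weight e₁ + weight e₂ + 3)
countPoly π (P ⨾ Q)            = countPoly π P :+ countPoly π Q
countPoly π (ifNonZero e P Q)  = con (weight e + 1) :+ (countPoly π P :+ countPoly π Q)
countPoly π (whileNonZero e P) =
  boundPoly π e :* (con (weight e + 1) :+ countPoly π P) :+ con (weight e + 1)

boundDegree : (ℕ → ℕ) → Expr → ℕ
boundDegree δ (var x) = δ x
boundDegree δ _       = 0

-- The exponent of X = 2^n in the step count: composition takes the maximum, nesting adds. Only the
-- loop over masks has degree 1, and it is never nested in another such loop, so the whole program
-- computes to degree 1.
degree : (ℕ → ℕ) → Program → ℕ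
degree δ (P ⨾ Q)            = degree δ P ⊔ degree δ Q
degree δ (ifNonZero e P Q)  = degree δ P ⊔ degree δ Q
degree δ (whileNonZero e P) = boundDegree δ e + degree δ P
degree δ _                  = 0

module _ {β δ : ℕ → ℕ} {π : ℕ → Poly} {m n : ℕ} (X : ℕ) .{{_ : NonZero X}}
         (β≤ : ∀ x → β x ≤ X ^ δ x * ⟦ π x ⟧ m n) where

  private
    widen : ∀ {a c} d → a ≤ c → X ^ a * d ≤ X ^ c * d
    widen d a≤c = *-monoˡ-≤ d (^-monoʳ-≤ X a≤c)

    absorb : ∀ a d → d ≤ X ^ a * d
    absorb a d = m≤n*m d (X ^ a) {{m^n≢0 X a}}

    join : ∀ a c {d e x y} → x ≤ X ^ a * d → y ≤ X ^ c * e → x + y ≤ X ^ (a ⊔ c) * (d + e)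
    join a c {d} {e} p q = ≤-trans
      (+-mono-≤ (≤-trans p (widen d (m≤m⊔n a c))) (≤-trans q (widen e (m≤n⊔m a c))))
      (≤-reflexive (sym (*-distribˡ-+ (X ^ (a ⊔ c)) d e)))

    bound≤ : ∀ e → bound β e ≤ X ^ boundDegree δ e * ⟦ boundPoly π e ⟧ m n
    bound≤ (lit v)         = z≤n
    bound≤ (var x)         = β≤ x
    bound≤ (a [ e ])       = z≤n
    bound≤ (binop o e₁ e₂) = z≤n

  count≤ : ∀ P → count β P ≤ X ^ degree δ P * ⟦ countPoly π P ⟧ m n
  count≤ skip              = absorb 0 _
  count≤ (x := e)          = absorb 0 _
  count≤ (a [ e₁ ]:= e₂)   = absorb 0 _
  count≤ (P ⨾ Q)           = join (degree δ P) (degree δ Q) (count≤ P) (count≤ Q)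
  count≤ (ifNonZero e P Q) = join 0 (degree δ P ⊔ degree δ Q) (absorb 0 (weight e + 1)) (
    join (degree δ P) (degree δ Q) (count≤ P) (count≤ Q))
  count≤ (whileNonZero e P) = begin
    bound β e * (w + count β P) + w
      ≤⟨ +-mono-≤ (*-mono-≤ (bound≤ e) (join 0 c (absorb 0 w) (count≤ P))) (absorb (a + c) w) ⟩
    X ^ a * b * (X ^ c * (w + q)) + X ^ (a + c) * w ≡⟨ cong (_+ X ^ (a + c) * w) (lemma (X ^ a) b (X ^ c) (w + q)) ⟩
    X ^ a * X ^ c * (b * (w + q)) + X ^ (a + c) * w
      ≡⟨ cong (λ z → z * (b * (w + q)) + X ^ (a + c) * w) (^-distribˡ-+-* X a c) ⟨
    X ^ (a + c) * (b * (w + q)) + X ^ (a + c) * w   ≡⟨ *-distribˡ-+ (X ^ (a + c)) _ w ⟨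
    X ^ (a + c) * (b * (w + q) + w)                 ∎
    where
    open ≤-Reasoning
    w = weight e + 1
    a = boundDegree δ e
    c = degree δ P
    b = ⟦ boundPoly π e ⟧ m n
    q = ⟦ countPoly π P ⟧ m n
    lemma : ∀ x b y z → x * b * (y * z) ≡ x * y * (b * z)
    lemma = solve-∀

-- Input and output cells

fromList-tabulateˡ : ∀ {N} (f : Fin N → ℕ) rest i → fromList (tabulate f ++ rest) (toℕ i) ≡ f i
fromList-tabulateˡ f rest zero    = refl
fromList-tabulateˡ f rest (suc i) = fromList-tabulateˡ (f ∘ suc) rest i

fromList-tabulateʳ : ∀ {N} (f : Fin N → ℕ) rest j → fromList (tabulate f ++ rest) (N + j) ≡ fromList rest j
fromList-tabulateʳ {zero}  f rest j = refl
fromList-tabulateʳ {suc N} f rest j = fromList-tabulateʳ (f ∘ suc) rest j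

module _ {N : ℕ} where

  private
    matrix : ∀ {M} → (Fin M → Fin N → ℕ) → List ℕ
    matrix g = concat (tabulate λ i → tabulate (g i))

    split : ∀ {M} (g : Fin (suc M) → Fin N → ℕ) rest j →
            fromList (matrix g ++ rest) j ≡ fromList (tabulate (g zero) ++ (matrix (g ∘ suc) ++ rest)) j
    split g rest j = cong (λ vs → fromList vs j) (++-assoc (tabulate (g zero)) (matrix (g ∘ suc)) rest)

  fromList-matrixˡ : ∀ {M} (g : Fin M → Fin N → ℕ) rest i j →
                     fromList (matrix g ++ rest) (toℕ i * N + toℕ j) ≡ g i j
  fromList-matrixˡ g rest zero    j = trans (split g rest (toℕ j)) (fromList-tabulateˡ (g zero) _ j)
  fromList-matrixˡ g rest (suc i) j = begin
    fromList (matrix g ++ rest) (N + toℕ i * N + toℕ j)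
      ≡⟨ cong (fromList (matrix g ++ rest)) (+-assoc N (toℕ i * N) (toℕ j)) ⟩
    fromList (matrix g ++ rest) (N + (toℕ i * N + toℕ j)) ≡⟨ split g rest (N + (toℕ i * N + toℕ j)) ⟩
    _ ≡⟨ fromList-tabulateʳ (g zero) _ (toℕ i * N + toℕ j) ⟩
    fromList (matrix (g ∘ suc) ++ rest) (toℕ i * N + toℕ j) ≡⟨ fromList-matrixˡ (g ∘ suc) rest i j ⟩
    g (suc i) j ∎
    where open ≡-Reasoning

  fromList-matrixʳ : ∀ {M} (g : Fin M → Fin N → ℕ) rest j →
                     fromList (matrix g ++ rest) (M * N + j) ≡ fromList rest j
  fromList-matrixʳ {zero}  g rest j = refl
  fromList-matrixʳ {suc M} g rest j = begin
    fromList (matrix g ++ rest) (N + M * N + j)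
      ≡⟨ cong (fromList (matrix g ++ rest)) (+-assoc N (M * N) j) ⟩
    fromList (matrix g ++ rest) (N + (M * N + j)) ≡⟨ split g rest (N + (M * N + j)) ⟩
    _ ≡⟨ fromList-tabulateʳ (g zero) _ (M * N + j) ⟩
    fromList (matrix (g ∘ suc) ++ rest) (M * N + j) ≡⟨ fromList-matrixʳ (g ∘ suc) rest j ⟩
    fromList rest j ∎
    where open ≡-Reasoning

-- `Outputs` for an arbitrary cell function, which can be shifted while the list is consumed from
-- the front.
Reads : (ℕ → ℕ) → List ℕ → Set
Reads f vs = ∀ (i : Fin (length vs)) → f (toℕ i) ≡ lookup vs i

reads-∷ : ∀ f {v vs} → f 0 ≡ v → Reads (f ∘ suc) vs → Reads f (v ∷ vs)
reads-∷ f p q zero    = p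
reads-∷ f p q (suc i) = q i

reads-tabulate-++ : ∀ f {N} (g : Fin N → ℕ) {vs} → (∀ i → f (toℕ i) ≡ g i) → Reads (f ∘ (N +_)) vs →
                    Reads f (tabulate g ++ vs)
reads-tabulate-++ f {zero}  g p q = q
reads-tabulate-++ f {suc N} g p q = reads-∷ f (p zero) (reads-tabulate-++ (f ∘ suc) (g ∘ suc) (p ∘ suc) q)

reads-tabulate : ∀ f {N} (g : Fin N → ℕ) → (∀ i → f (toℕ i) ≡ g i) → Reads f (tabulate g)
reads-tabulate f {suc N} g p = reads-∷ f (p zero) (reads-tabulate (f ∘ suc) (g ∘ suc) (p ∘ suc))

-- The digits of k

∑-front : ∀ j f → ∑< (suc j) f ≡ f 0 + ∑< j (f ∘ suc)
∑-front zero    f = refl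
∑-front (suc j) f = trans (cong (f (suc j) +_) (∑-front j f)) (lemma (f (suc j)) (f 0) _)
  where
  lemma : ∀ a b c → a + (b + c) ≡ b + (a + c)
  lemma = solve-∀

digits≤2 : ∀ b i → fromList (digits b) i ≤ 2
digits≤2 0ᵇ       i       = z≤n
digits≤2 2[1+ b ] zero    = ≤-refl
digits≤2 2[1+ b ] (suc i) = digits≤2 b i
digits≤2 1+[2 b ] zero    = s≤s z≤n
digits≤2 1+[2 b ] (suc i) = digits≤2 b i

digitSum : ℕ → ℕᵇ → ℕ
digitSum j b = ∑< j (λ i → 2 ^ i * fromList (digits b) i)

∑-digits-∷ : ∀ j v vs → ∑< (suc j) (λ i → 2 ^ i * fromList (v ∷ vs) i) ≡
                        v + 2 * ∑< j (λ i → 2 ^ i * fromList vs i)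
∑-digits-∷ j v vs = trans (∑-front j _) (cong₂ _+_ (*-identityˡ v)
  (trans (∑-cong j λ i _ → *-assoc 2 (2 ^ i) (fromList vs i)) (∑-* j 2 _)))

-- If b has more than j digits, then both numbers are at least j.
digitSum-exact : ∀ j b → digitSum j b ≡ toℕᵇ b ⊎ (j ≤ digitSum j b × j ≤ toℕᵇ b)
digitSum-exact zero    b  = inj₂ (z≤n , z≤n)
digitSum-exact (suc j) 0ᵇ = inj₁ (trans (∑-cong (suc j) λ i _ → *-zeroʳ (2 ^ i))
                                         (trans (∑-const (suc j) 0) (*-zeroʳ (suc j))))
digitSum-exact (suc j) 2[1+ b ] rewrite ∑-digits-∷ j 2 (digits b) with digitSum-exact j b
... | inj₁ eq = inj₁ (trans (cong (λ z → 2 + 2 * z) eq) (sym (*-distribˡ-+ 2 1 (toℕᵇ b))))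
... | inj₂ (p , q) = inj₂ (s≤s (≤-trans p (≤-trans (m≤m+n _ _) (n≤1+n _))) ,
                           ≤-trans (s≤s q) (m≤m+n _ _))
digitSum-exact (suc j) 1+[2 b ] rewrite ∑-digits-∷ j 1 (digits b) with digitSum-exact j b
... | inj₁ eq = inj₁ (cong (λ z → 1 + 2 * z) eq)
... | inj₂ (p , q) = inj₂ (s≤s (≤-trans p (m≤m+n _ _)) , s≤s (≤-trans q (m≤m+n _ _)))

digitSum-⊓ : ∀ j b → digitSum j b ⊓ j ≡ toℕᵇ b ⊓ j
digitSum-⊓ j b with digitSum-exact j b
... | inj₁ eq      = cong (_⊓ j) eq
... | inj₂ (p , q) = trans (m≥n⇒m⊓n≡n p) (sym (m≥n⇒m⊓n≡n q))

-- Solutions as functions on ℕ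

sum-∑< : ∀ j (f : ℕ → ℕ) → sum {j} (f ∘ toℕ) ≡ ∑< j f
sum-∑< zero  f = refl
sum-∑< (suc j) f = trans (cong (f 0 +_) (sum-∑< j (f ∘ suc))) (sym (∑-front j f))

sum-pick : ∀ {r} (c : Fin r) (f : Fin r → ℕ) → sum (λ i → if does (c Fin.≟ i) then f i else 0) ≡ f c
sum-pick {suc r} zero    f = trans (cong (f zero +_) (sum-replicate-zero r)) (+-identityʳ (f zero))
sum-pick {suc r} (suc c) f = sum-pick c (f ∘ suc)

-- Once the sums are exchanged, each client retains only the term of its own cluster.
cost-assignment : ∀ {m n} (I : Instance m n) (S : Solution I) →
                  let open Instance I; open Solution S in
                  cost I S ≡ sum (λ j → d (facility (center (cluster j))) (client j))
cost-assignment {m} {n} I S = trans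
  (∑-comm (λ i j → if does (cluster j Fin.≟ i) then d (facility (center i)) (client j) else 0))
  (sum-cong-≗ λ j → sum-pick (cluster j) (λ i → d (facility (center i)) (client j)))
  where
  open Instance I
  open Solution S

-- The default 0 is an admissible slot and an admissible center, since k and m are positive; hence
-- `extend-<`.
extend : ∀ {j} → (Fin j → ℕ) → ℕ → ℕ
extend {j} f x with x <? j
... | yes x<j = f (fromℕ< x<j)
... | no  _   = 0

extend-toℕ : ∀ {j} (f : Fin j → ℕ) i → extend f (toℕ i) ≡ f i
extend-toℕ {j} f i with toℕ i <? j
... | yes i<j = cong f (Fin.fromℕ<-toℕ i i<j)
... | no  i≮j = contradiction (Fin.toℕ<n i) i≮j

extend-< : ∀ {j b} (f : Fin j → ℕ) → 0 < b → (∀ i → f i < b) → ∀ x → extend f x < b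
extend-< {j} f 0<b h x with x <? j
... | yes x<j = h (fromℕ< x<j)
... | no  _   = 0<b

-- If k > m, then one slot per facility is enough.
centers-⊓ : ∀ {m n} {I : Instance m n} (S : Solution I) → let open Instance I; open Solution S in
            Σ[ c ∈ (ℕ → ℕ) ] Σ[ g ∈ (ℕ → ℕ) ]
              ((∀ l → l < k ⊓ m → c l < m) × (∀ x → x < n → g x < k ⊓ m) ×
               (∀ j → c (g (toℕ j)) ≡ toℕ (center (cluster j))))
centers-⊓ {m} {n} {I} S with ≤-total (Instance.k I) m
... | inj₁ k≤m rewrite m≤n⇒m⊓n≡m k≤m =
  extend (toℕ ∘ center) , extend (toℕ ∘ cluster) ,
  (λ l _ → extend-< (toℕ ∘ center) (>-nonZero⁻¹ m {{m-nonZero}}) (Fin.toℕ<n ∘ center) l) ,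
  (λ x _ → extend-< (toℕ ∘ cluster) (>-nonZero⁻¹ k {{k-nonZero}})
             (λ j → <-≤-trans (Fin.toℕ<n (cluster j)) r≤k) x) ,
  λ j → trans (cong (extend (toℕ ∘ center)) (extend-toℕ (toℕ ∘ cluster) j))
              (extend-toℕ (toℕ ∘ center) (cluster j))
  where
  open Instance I
  open Solution S
... | inj₂ m≤k rewrite m≥n⇒m⊓n≡n m≤k =
  (λ l → l) , extend (toℕ ∘ center ∘ cluster) , (λ l l<m → l<m) ,
  (λ x _ → extend-< (toℕ ∘ center ∘ cluster) (>-nonZero⁻¹ m {{m-nonZero}}) (Fin.toℕ<n ∘ center ∘ cluster) x) ,
  extend-toℕ (toℕ ∘ center ∘ cluster)
  where
  open Instance I
  open Solution S

-- Choice of the polynomials and the final assembly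

-- Stands in for a maximum: with natural coefficients a sum dominates each of its terms.
sumPoly : List Poly → Poly
sumPoly []       = con 0
sumPoly (b ∷ bs) = b :+ sumPoly bs

∈⇒≤sumPoly : ∀ {b bs} m n → b ∈ bs → ⟦ b ⟧ m n ≤ ⟦ sumPoly bs ⟧ m n
∈⇒≤sumPoly m n (here refl) = m≤m+n _ _
∈⇒≤sumPoly {bs = b ∷ _} m n (there i) = ≤-trans (∈⇒≤sumPoly m n i) (m≤n+m _ (⟦ b ⟧ m n))

μᵖ : Poly
μᵖ = con 1 :+ (𝑚 :* 𝑛 :+ 𝑚 :* 𝑚)

module _ (p : Poly) where

  -- An exponent of 2 sufficient for `m * A ^ n`, from m < 2^m and A = 2^(1 + μD).
  slotᵖ : Poly
  slotᵖ = 𝑚 :+ (con 1 :+ μᵖ :* p) :* 𝑛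

  -- One entry per size hypothesis of the correctness proof. Hypotheses on powers are listed by an
  -- exponent, the others by the value itself; both fit into one list because b < 2^b.
  requirements : List Poly
  requirements =
    con 2 :+ ((𝑛 :+ 𝑚) :* (𝑛 :+ 𝑚) :+ (𝑛 :+ 𝑚)) ∷ μᵖ ∷ μᵖ :* p ∷ 𝑛 ∷ con 1 :+ μᵖ :* p ∷ slotᵖ ∷
    𝑛 :+ slotᵖ :* 𝑚 ∷ majorant p ∷ con 1 :+ 𝑚 ∷ []

  -- The numbers occurring in the run have at most 1 + bitsᵖ bits.
  bitsᵖ : Poly
  bitsᵖ = sumPoly requirements

  -- Together with `boundsᵖ` this splits the counter bounds `β` into a power of 2^n and a
  -- polynomial.
  degrees : ℕ → ℕ
  degrees = (((λ _ → 0) [ vS ↦ 1 ]) [ vx ↦ 0 ]) [ ve ↦ 0 ]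

  boundsᵖ : ℕ → Poly
  boundsᵖ = (((λ _ → 𝑚) [ vS ↦ con 1 ]) [ vx ↦ 𝑛 ]) [ ve ↦ μᵖ :* p :+ 𝑛 ]

  -- The squared factor is `κ`: the bound N on all numbers is a power of 2 of length 1 + `bitsᵖ`.
  timeᵖ : Poly
  timeᵖ = countPoly boundsᵖ (program p) :* ((con 1 :+ bitsᵖ) :* (con 1 :+ bitsᵖ))

  module Solve {m n : ℕ} (I : Instance m n) (d≤ : ∀ x y → Instance.d I x y ≤ ⟦ p ⟧ m n) where

    open Instance I using (Carrier; d; client; facility; k-nonZero; m-nonZero) renaming (k to k₀)

    k D B N : ℕ
    k = k₀ ⊓ m
    D = ⟦ p ⟧ m n
    B = ⟦ bitsᵖ ⟧ m n
    N = 2 ^ B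

    inp : ℕ → ℕ
    inp = fromList (encodeInstance I)

    open Verify m n k D N inp (m⊓n≤n k₀ m)

    point : Fin (n + m) → Carrier
    point = client Vector.++ facility

    dist-entry : ∀ i j → dist (toℕ i) (toℕ j) ≡ d (facility i) (client j)
    dist-entry i j = begin
      rest ((n + toℕ i) * (n + m) + toℕ j)
        ≡⟨ cong₂ (λ a b → rest (a * (n + m) + b)) (Fin.toℕ-↑ʳ n i) (Fin.toℕ-↑ˡ j m) ⟨
      rest (toℕ (n ↑ʳ i) * (n + m) + toℕ (j ↑ˡ m))
        ≡⟨ fromList-matrixˡ (λ i j → d (point i) (point j)) (digits (fromℕ k₀)) (n ↑ʳ i) (j ↑ˡ m) ⟩
      d (point (n ↑ʳ i)) (point (j ↑ˡ m))
        ≡⟨ cong₂ d (lookup-++ʳ client facility i) (lookup-++ˡ client facility j) ⟩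
      d (facility i) (client j) ∎
      where
      open ≡-Reasoning
      rest : ℕ → ℕ
      rest j = inp (2 + j)

    dist≤D : ∀ {c x} → c < m → x < n → dist c x ≤ D
    dist≤D {c} {x} c<m x<n = begin
      dist c x ≡⟨ cong₂ dist (Fin.toℕ-fromℕ< c<m) (Fin.toℕ-fromℕ< x<n) ⟨
      dist (toℕ (fromℕ< c<m)) (toℕ (fromℕ< x<n)) ≡⟨ dist-entry (fromℕ< c<m) (fromℕ< x<n) ⟩
      d (facility (fromℕ< c<m)) (client (fromℕ< x<n)) ≤⟨ d≤ _ _ ⟩
      D ∎
      where open ≤-Reasoning

    2^≤N : ∀ {b} → b ∈ requirements → 2 ^ ⟦ b ⟧ m n ≤ N
    2^≤N i = ^-monoʳ-≤ 2 (∈⇒≤sumPoly m n i)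

    ≤N : ∀ {b} → b ∈ requirements → ⟦ b ⟧ m n ≤ N
    ≤N i = ≤-trans (<⇒≤ (n<2^n _)) (2^≤N i)

    e : ℕ
    e = ⟦ slotᵖ ⟧ m n

    slot≤2^e : m * A ^ n ≤ 2 ^ e
    slot≤2^e = begin
      m * A ^ n                      ≤⟨ *-mono-≤ (<⇒≤ (n<2^n m)) (≤-reflexive (^-*-assoc 2 (1 + μ * D) n)) ⟩
      2 ^ m * 2 ^ ((1 + μ * D) * n)  ≡⟨ ^-distribˡ-+-* 2 m _ ⟨
      2 ^ e                          ∎
      where open ≤-Reasoning

    slots≤2^ : 2 ^ n * (m * A ^ n) ^ k ≤ 2 ^ (n + e * m)
    slots≤2^ = begin
      2 ^ n * (m * A ^ n) ^ k   ≤⟨ *-monoʳ-≤ (2 ^ n) (^-monoˡ-≤ k slot≤2^e) ⟩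
      2 ^ n * (2 ^ e) ^ k       ≡⟨ cong (2 ^ n *_) (^-*-assoc 2 e k) ⟩
      2 ^ n * 2 ^ (e * k)       ≤⟨ *-monoʳ-≤ (2 ^ n) (^-monoʳ-≤ 2 (*-monoʳ-≤ e (m⊓n≤n k₀ m))) ⟩
      2 ^ n * 2 ^ (e * m)       ≡⟨ ^-distribˡ-+-* 2 n (e * m) ⟨
      2 ^ (n + e * m)           ∎
      where open ≤-Reasoning

    1≤k : 1 ≤ k
    1≤k = ⊓-glb (>-nonZero⁻¹ k₀ {{k-nonZero}}) (>-nonZero⁻¹ m {{m-nonZero}})

    Result : State → Set
    Result s = ∃[ a ] (total k (λ _ → 0) ≤ m ^ k * total 0 a × arrays s 1 0 ≡ k ×
      (∀ l → 0 ≤ l → l < k → arrays s 1 (suc l) ≡ a l × a l < m) ×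
      (∀ x → 0 ≤ x → x < n → arrays s 1 (suc (k + x)) < k ×
        (∀ l → l < k → dist (a (arrays s 1 (suc (k + x)))) x ≤ dist (a l) x)))

    run : Run (program p) (initial (encodeInstance I)) Result
    run = run-program 1≤k dist≤D
      (≤N (here refl)) (≤N (there (here refl))) (≤N (there (there (here refl))))
      (2^≤N (there (there (there (here refl)))))
      (2^≤N (there (there (there (there (here refl))))))
      (≤-trans slot≤2^e (2^≤N (there (there (there (there (there (here refl))))))))
      (≤-trans slots≤2^ (2^≤N (there (there (there (there (there (there (here refl)))))))))
      (fromList (digits (fromℕ k₀))) refl refl
      (fromList-matrixʳ (λ i j → d (point i) (point j)) (digits (fromℕ k₀)))
      (digits≤2 (fromℕ k₀))
      (trans (digitSum-⊓ m (fromℕ k₀)) (cong (_⊓ m) (toℕ-fromℕ k₀)))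
      (2^≤N (there (there (there (there (there (there (there (there (here refl))))))))))
      p refl
      (≤N (there (there (there (there (there (there (there (here refl)))))))))
      (λ _ → refl)

    size-N : size N ≡ 1 + B
    size-N = cong suc (⌊log₂[2^n]⌋≡n B)

    ↦-≤ : ∀ {f δ : ℕ → ℕ} {π : ℕ → Poly} x {v w q} → v ≤ (2 ^ n) ^ w * ⟦ q ⟧ m n →
          (∀ y → f y ≤ (2 ^ n) ^ δ y * ⟦ π y ⟧ m n) →
          ∀ y → (f [ x ↦ v ]) y ≤ (2 ^ n) ^ (δ [ x ↦ w ]) y * ⟦ (π [ x ↦ q ]) y ⟧ m n
    ↦-≤ x v≤ f≤ y with x ≡ᵇ y
    ... | true  = v≤
    ... | false = f≤ y

    time≤ : count β (program p) * κ ≤ 2 ^ n * ⟦ timeᵖ ⟧ m n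
    time≤ = begin
      count β (program p) * κ
        ≤⟨ *-monoˡ-≤ κ (count≤ {β} {degrees} {boundsᵖ} {m} {n} (2 ^ n) {{m^n≢0 2 n}} bounds (program p)) ⟩
      (2 ^ n) ^ 1 * c * κ   ≡⟨ cong (λ z → z * c * κ) (*-identityʳ (2 ^ n)) ⟩
      2 ^ n * c * κ         ≡⟨ *-assoc (2 ^ n) c κ ⟩
      2 ^ n * (c * κ)       ≡⟨ cong (λ z → 2 ^ n * (c * (z * z))) size-N ⟩
      2 ^ n * ⟦ timeᵖ ⟧ m n ∎
      where
      open ≤-Reasoning
      c = ⟦ countPoly boundsᵖ (program p) ⟧ m n
      bounds : ∀ y → β y ≤ (2 ^ n) ^ degrees y * ⟦ boundsᵖ y ⟧ m n
      bounds =
        ↦-≤ ve {w = 0} {μᵖ :* p :+ 𝑛} (≤-reflexive (sym (*-identityˡ _)))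
          (↦-≤ vx {w = 0} {𝑛} (≤-reflexive (sym (*-identityˡ _)))
            (↦-≤ {δ = λ _ → 0} {λ _ → 𝑚} vS {w = 1} {con 1} (≤-reflexive (sym (trans (*-identityʳ _) (*-identityʳ _))))
              (λ _ → ≤-reflexive (sym (*-identityˡ _)))))

    module Extract {s : State} (result : Result s) where

      a : ℕ → ℕ
      a = proj₁ result
      good = proj₁ (proj₂ result)
      r≡k = proj₁ (proj₂ (proj₂ result))
      centers = proj₁ (proj₂ (proj₂ (proj₂ result)))
      near = proj₂ (proj₂ (proj₂ (proj₂ result)))

      g : ℕ → ℕ
      g x = arrays s 1 (suc (k + x))

      g<k : ∀ {x} → x < n → g x < k
      g<k x<n = proj₁ (near _ z≤n x<n)

      a<m : ∀ {l} → l < k → a l < m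
      a<m l<k = proj₂ (centers _ z≤n l<k)

      S : Solution I
      S = record
        { r       = k
        ; r≤k     = m⊓n≤m k₀ m
        ; center  = λ l → fromℕ< (a<m (Fin.toℕ<n l))
        ; cluster = λ j → fromℕ< (g<k (Fin.toℕ<n j))
        }

      cost-∑< : ∀ T (c h : ℕ → ℕ) →
                (∀ j → c (h (toℕ j)) ≡ toℕ (Solution.center T (Solution.cluster T j))) →
                cost I T ≡ ∑< n (λ x → dist (c (h x)) x)
      cost-∑< T c h eq = trans (cost-assignment I T) (trans
        (sum-cong-≗ λ j → sym (trans (cong (λ c → dist c (toℕ j)) (eq j)) (dist-entry (center (cluster j)) j)))
        (sum-∑< n (λ x → dist (c (h x)) x)))
        where open Solution T

      S-optimal : Optimal I S
      S-optimal T = let c , h , c<m , h<k , eq = centers-⊓ T in begin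
        cost I S ≡⟨ cost-∑< S a g (λ j → sym (trans (Fin.toℕ-fromℕ< _) (cong a (Fin.toℕ-fromℕ< _)))) ⟩
        ∑< n (λ x → dist (a (g x)) x)
          ≤⟨ optimal (λ _ → 0) a c g h good
               (λ x l x<n → proj₂ (near x z≤n x<n) l)
               (λ x x<n → dist≤D (a<m (g<k x<n)) x<n)
               c<m h<k
               (λ x x<n → dist≤D (c<m (h x) (h<k x x<n)) x<n) ⟩
        ∑< n (λ x → dist (c (h x)) x) ≡⟨ cost-∑< T c h eq ⟨
        cost I T ∎
        where open ≤-Reasoning

      S-outputs : Outputs s (encodeSolution S)
      S-outputs = reads-∷ (arrays s 1) r≡k
        (reads-tabulate-++ (arrays s 1 ∘ suc) (toℕ ∘ Solution.center S)
          (λ l → trans (proj₁ (centers (toℕ l) z≤n (Fin.toℕ<n l))) (sym (Fin.toℕ-fromℕ< _)))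
          (reads-tabulate g (toℕ ∘ Solution.cluster S) (λ j → sym (Fin.toℕ-fromℕ< _))))

theorem12 : (p : Poly) →
    ∃[ P ] ∃[ q ]
    (∀ (m n : ℕ) (I : Instance m n) →
    (∀ x y → Instance.d I x y ≤ ⟦ p ⟧ m n) →
    ∃[ s ] ∃[ t ]
    ((P ∶ initial (encodeInstance I) ⇓ s within t) ×
    t ≤ 2 ^ n * ⟦ q ⟧ m n ×
    (∃[ S ] (Optimal I S × Outputs s (encodeSolution S)))))
theorem12 p = program p , timeᵖ p , λ m n I d≤ →
  let open Solve p I d≤
      s , t , D , t≤ , result = run
      open Extract {s} result in
  s , t , D , ≤-trans t≤ time≤ , S , S-optimal , S-outputs
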